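{- Let $N$ be a structural conflict net. If $N$ has a $\sqsubseteq_1^\infty$-largest BD-process (that is, if there is a GR-process $P$ of $N$ such that $Q \sqsubseteq_1^\infty P$ for every GR-process $Q$ of $N$), then $N$ is (semantically) conflict-free.
   Context: **Multisets.** A multiset over a set $X$ is a function $A:X\to\mathbb{N}$ (with $0\in\mathbb{N}$); $x\in A$ iff $A(x)>0$; $A\subseteq B$ iff $A(x)\le B(x)$ for all $x$; $(A+B)(x)=A(x)+B(x)$; $(A-B)(x)=\max(A(x)-B(x),0)$; $|A|=\sum_x A(x)$; $A$ is finite iff $|A|<\infty$. $\{t,u\}$ denotes a multiset (so $\{t,t\}$ contains $t$ twice). $G\upharpoonright\{t\}$ is the restriction of $G$ to $\{t\}$, i.e. the multiset consisting of $G(t)$ copies of $t$. A multiset with all values $\le 1$ is identified with a set, and multisets that differ only in their underlying domain (by elements of multiplicity 0) are identified. **Nets.** A net is a tuple $N=(S,T,F,M_0)$ with $S,T$ disjoint sets (places, transitions), $F:(S\times T)\cup(T\times S)\to\mathbb{N}$, and $M_0:S\to\mathbb{N}$ (initial marking), such that for all $t\in T$ the set $\{s\mid F(s,t)>0\}$ is finite and non-empty and $\{s\mid F(t,s)>0\}$ is finite. For $x\in S\cup T$ the multisets ${}^\bullet x$ and $x^\bullet$ are given by ${}^\bullet x(y)=F(y,x)$ and $x^\bullet(y)=F(x,y)$ (with $F$ taken to be $0$ where undefined), extended linearly to multisets $X$ by ${}^\bullet X=\sum_x X(x)\cdot{}^\bullet x$, $X^\bullet=\sum_x X(x)\cdot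 x^\bullet$. A marking is a multiset $M\in\mathbb{N}^S$. For a non-empty finite multiset $G\in\mathbb{N}^T$, $M\xrightarrow{G}M'$ iff ${}^\bullet G\subseteq M$ and $M'=(M-{}^\bullet G)+G^\bullet$; write $M\xrightarrow{G}$ if such $M'$ exists. For a word $\sigma=t_1\cdots t_n\in T^*$, $M\xrightarrow{\sigma}M'$ means that firing the single transitions $t_1,\dots,t_n$ in this order leads from $M$ to $M'$ (for the empty word, $M'=M$). $M$ is reachable iff $M_0\xrightarrow{\sigma}M$ for some $\sigma\in T^*$. **Conflict.** A finite non-empty multiset $G\in\mathbb{N}^T$ is in (semantic) conflict in $M$ iff not $M\xrightarrow{G}$, but $M\xrightarrow{G\upharpoonright\{t\}}$ for all $t\in G$. $N$ is (semantically) conflict-free iff no finite non-empty multiset $G\in\mathbb{N}^T$ is in semantic conflict in any reachable marking. $N$ is a structural conflict net iff for all $t,u\in T$ (possibly $t=u$): if $M\xrightarrow{\{t,u\}}$ for some reachable marking $M$, then ${}^\bullet t\cap{}^\bullet u=\emptyset$. **GR-processes.** A (GR-)process of $N=(S,T,F,M_0)$ is a pair $P=(\mathcal{N},\pi)$ where $\mathcal{N}=(\mathcal{S},\mathcal{T},\mathcal{F},\mathcal{M}_0)$ is a net such that: (i) for all $s\in\mathcal{S}$, $|{}^\bullet s|\le 1$, $|s^\bullet|\le 1$, and $\mathcal{M}_0(s)=1$ if ${}^\bullet s=\emptyset$ and $\mathcal{M}_0(s)=0$ otherwise; (ii) $\mathcal{F}$ is acyclic, i.e. $(x,x)\notin\mathcal{F}^+$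 for all $x\in\mathcal S\cup\mathcal T$, where $\mathcal{F}^+$ is the transitive closure of $\{(x,y)\mid\mathcal{F}(x,y)>0\}$; (iii) $\{t\in\mathcal{T}\mid(t,u)\in\mathcal{F}^+\}$ is finite for all $u\in\mathcal{T}$; and $\pi:\mathcal{S}\cup\mathcal{T}\to S\cup T$ is a function with $\pi(\mathcal{S})\subseteq S$, $\pi(\mathcal{T})\subseteq T$, $M_0(s)=|\pi^{ -1}(s)\cap\mathcal{M}_0|$ for all $s\in S$, and $F(s,\pi(t))=|\pi^{ -1}(s)\cap{}^\bullet t|$, $F(\pi(t),s)=|\pi^{ -1}(s)\cap t^\bullet|$ for all $t\in\mathcal{T}$, $s\in S$. $P$ is finite iff $\mathcal{T}$ is finite. ${\rm GR}(N)$ (resp. ${\rm GR}_{fin}(N)$) is the collection of all (finite) GR-processes of $N$. For processes $P=((\mathcal{S},\mathcal{T},\mathcal{F},\mathcal{M}_0),\pi)$ and $P'=((\mathcal{S}',\mathcal{T}',\mathcal{F}',\mathcal{M}_0'),\pi')$ of the same net, $P'$ is a prefix of $P$ (and $P$ an extension of $P'$), $P'\le P$, iff $\mathcal{S}'\subseteq\mathcal{S}$, $\mathcal{T}'\subseteq\mathcal{T}$, $\mathcal{M}'_0=\mathcal{M}_0$, $\mathcal{F}'=\mathcal{F}\upharpoonright(\mathcal{S}'\times\mathcal{T}'\cup\mathcal{T}'\times\mathcal{S}')$ and $\pi'=\pi\upharpoonright(\mathcal{S}'\cup\mathcal{T}')$. $P\cong P'$ (isomorphic) iff there is a bijection $\phi$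 mapping places to places and transitions to transitions, with $\mathcal{M}'_0(\phi(s))=\mathcal{M}_0(s)$, $\mathcal{F}'(\phi(x),\phi(y))=\mathcal{F}(x,y)$ and $\pi=\pi'\circ\phi$. **Swapping.** For a process $P=((\mathcal{S},\mathcal{T},\mathcal{F},\mathcal{M}_0),\pi)$ and $p,q\in\mathcal{S}$ with $(p,q)\notin\mathcal{F}^+\cup(\mathcal{F}^+)^{ -1}$ and $\pi(p)=\pi(q)$, $\mathrm{swap}(P,p,q)=((\mathcal{S},\mathcal{T},\mathcal{F}',\mathcal{M}_0),\pi)$, where $\mathcal{F}'(p,y)=\mathcal{F}(q,y)$ and $\mathcal{F}'(q,y)=\mathcal{F}(p,y)$ for $y\in\mathcal{T}$, and $\mathcal{F}'(x,y)=\mathcal{F}(x,y)$ otherwise. $P\equiv_1 Q$ iff $\mathrm{swap}(P,p,q)\cong Q$ for some such places $p,q$ of $P$; $\equiv_1^*$ is the reflexive and transitive closure of $\equiv_1$. **BD-processes and their order.** For $P,Q\in{\rm GR}(N)$, $P\equiv_1^\infty Q$ iff for every finite $P''\le P$ there are $Q'\equiv_1^* Q$ and $Q''\le Q'$ with $P''\cong Q''$, and vice versa, for every finite $Q''\le Q$ there are $P'\equiv_1^*P$ and $P''\le P'$ with $P''\cong Q''$. A BD-process is a $\equiv_1^\infty$-equivalence class of GR-processes. $P\sqsubseteq_1^\infty Q$ iff for every finite $P''\le P$ there are $P',Q'\in{\rm GR}_{fin}(N)$ with $P''\le P'\equiv_1^*Q'\le Q$. The relation $\sqsubseteq_1^\infty$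 is a preorder with kernel $\equiv_1^\infty$, hence induces a partial order on BD-processes; "$\sqsubseteq_1^\infty$-largest" refers to this order. -}

module Defs where

open import Axiom.ExcludedMiddle using (ExcludedMiddle)
open import Algebra.Properties.CommutativeMonoid.Sum using (sum)
open import Data.Fin.Base using (Fin)
open import Data.List.Base using (List; []; _∷_)
open import Data.List.Membership.Propositional using (_∈_)
open import Data.Nat.Base using (ℕ; _+_; _∸_; _⊓_; _≤_; _<_)
open import Data.Nat.Properties using (+-0-commutativeMonoid)
open import Data.Product.Base using (Σ; _×_; _,_; proj₁; ∃; ∃₂)
open import Data.Sum.Base using (_⊎_; inj₁; inj₂)
open import Data.Bool.Base using (if_then_else_)
open import Function.Base using (_∘_)
open import Function.Bundles using (_↔_; Inverse)
open import Function.Definitions using (Injective)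
open import Level using (Level; _⊔_) renaming (suc to lsuc)
open import Relation.Binary.Construct.Closure.ReflexiveTransitive using (Star)
open import Relation.Binary.Construct.Closure.Transitive using (TransClosure)
open import Relation.Binary.Core using (Rel)
open import Relation.Binary.PropositionalEquality.Core using (_≡_; _≗_)
open import Relation.Nullary.Decidable.Core using (does)
open import Relation.Nullary.Negation.Core using (¬_)
open import Relation.Unary using (Pred)

------------------------------------------------------------------------
-- Sets and multisets

FiniteSet : ∀ {a p} {X : Set a} → Pred X p → Set (a ⊔ p)
FiniteSet {X = X} P = ∃ λ (xs : List X) → ∀ {x} → P x → x ∈ xs

Multiset : ∀ {a} → Set a → Set a
Multiset X = X → ℕ

module _ {a} {X : Set a} where

  infix  4 _∈ᴹ_ _⊆ᴹ_ ∣_∣≡_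
  infixl 6 _+ᴹ_ _-ᴹ_
  infixl 7 _∩ᴹ_

  _∈ᴹ_ : X → Multiset X → Set
  x ∈ᴹ A = 0 < A x

  _⊆ᴹ_ : Multiset X → Multiset X → Set a
  A ⊆ᴹ B = ∀ x → A x ≤ B x

  _+ᴹ_ _-ᴹ_ _∩ᴹ_ : Multiset X → Multiset X → Multiset X
  (A +ᴹ B) x = A x + B x
  (A -ᴹ B) x = A x ∸ B x
  (A ∩ᴹ B) x = A x ⊓ B x

  Empty NonEmpty : Multiset X → Set a
  Empty    A = ∀ x → A x ≡ 0
  NonEmpty A = ∃ λ x → x ∈ᴹ A

  -- The individual copies of the elements of a multiset.  Their number is
  -- Σₓ A(x), also when X is infinite.
  Copies : Multiset X → Set a
  Copies A = Σ X λ x → Fin (A x)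

  ∣_∣≡_ : Multiset X → ℕ → Set a
  ∣ A ∣≡ n = Copies A ↔ Fin n

  FiniteMultiset : Multiset X → Set a
  FiniteMultiset A = ∃ λ n → ∣ A ∣≡ n

  AtMostOne : Multiset X → Set a
  AtMostOne A = ∃ λ n → n ≤ 1 × ∣ A ∣≡ n

  -- Σₓ A(x) · f(x), computed as the sum of f over the copies in A, so that
  -- no sum over an infinite type is needed.
  linearExtension : ∀ {b} {Y : Set b} → (X → Multiset Y) →
                    (A : Multiset X) → FiniteMultiset A → Multiset Y
  linearExtension f A (n , e) y =
    sum +-0-commutativeMonoid {n} λ i → f (proj₁ (Inverse.from e i)) y

------------------------------------------------------------------------
-- Nets

-- The data of a net.  The flow function F is split into its restrictions
-- to S × T and to T × S.
record PreNet ℓ : Set (lsuc ℓ) where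
  field
    Place Transition : Set ℓ
    Fˢᵗ : Place → Transition → ℕ
    Fᵗˢ : Transition → Place → ℕ
    M₀  : Multiset Place

  Marking : Set ℓ
  Marking = Multiset Place

  •ᵗ_ _ᵗ• : Transition → Multiset Place
  (•ᵗ t) s = Fˢᵗ s t
  (t ᵗ•) s = Fᵗˢ t s

  •ˢ_ _ˢ• : Place → Multiset Transition
  (•ˢ s) t = Fᵗˢ t s
  (s ˢ•) t = Fˢᵗ s t

  Node : Set ℓ
  Node = Place ⊎ Transition

  F : Node → Node → ℕ
  F (inj₁ s) (inj₂ t) = Fˢᵗ s t
  F (inj₂ t) (inj₁ s) = Fᵗˢ t s
  F _        _        = 0

  F⁺ : Rel Node ℓ
  F⁺ = TransClosure λ x y → 0 < F x y

  record IsNet : Set ℓ where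
    field
      pre-finite   : ∀ t → FiniteSet λ s → 0 < Fˢᵗ s t
      pre-nonempty : ∀ t → ∃ λ s → 0 < Fˢᵗ s t
      post-finite  : ∀ t → FiniteSet λ s → 0 < Fᵗˢ t s

record Net ℓ : Set (lsuc ℓ) where
  field
    preNet : PreNet ℓ
    isNet  : PreNet.IsNet preNet
  open PreNet preNet public

------------------------------------------------------------------------
-- The notions below use that sets have decidable equality and that
-- predicates have {0,1}-valued characteristic functions.  Excluded middle
-- is therefore taken as a parameter.

module _ (em : ∀ {a} → ExcludedMiddle a) where

  char : ∀ {a p} {X : Set a} → Pred X p → Multiset X
  char P x = if does (em {P = P x}) then 1 else 0

  ⁅_⁆ : ∀ {a} {X : Set a} → X → Multiset X
  ⁅ t ⁆ = char (_≡ t)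

  infixl 7 _↾_

  _↾_ : ∀ {a} {X : Set a} → Multiset X → X → Multiset X
  (G ↾ t) u = if does (em {P = u ≡ t}) then G u else 0

  preimage : ∀ {a b} {X : Set a} {Y : Set b} → (X → Y) → Y → Multiset X
  preimage π y = char λ x → π x ≡ y

  ----------------------------------------------------------------------
  -- Firing and conflict

  module _ {ℓ} (N : Net ℓ) where
    open Net N

    record Step (M : Marking) (G : Multiset Transition) (M′ : Marking) : Set ℓ where
      field
        finite   : FiniteMultiset G
        nonempty : NonEmpty G
        enabled  : linearExtension •ᵗ_ G finite ⊆ᴹ M
        result   : M′ ≗ (M -ᴹ linearExtension •ᵗ_ G finite) +ᴹ linearExtension _ᵗ• G finite

    Enables : Marking → Multiset Transition → Set ℓ
    Enables M G = ∃ λ M′ → Step M G M′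

    data Fires (M : Marking) : List Transition → Marking → Set ℓ where
      []  : ∀ {M′} → M′ ≗ M → Fires M [] M′
      _∷_ : ∀ {t σ M₁ M₂} → Step M ⁅ t ⁆ M₁ → Fires M₁ σ M₂ → Fires M (t ∷ σ) M₂

    Reachable : Marking → Set ℓ
    Reachable M = ∃ λ σ → Fires M₀ σ M

    InConflict : Multiset Transition → Marking → Set ℓ
    InConflict G M = ¬ Enables M G × (∀ t → t ∈ᴹ G → Enables M (G ↾ t))

    ConflictFree : Set ℓ
    ConflictFree = ∀ G → FiniteMultiset G → NonEmpty G →
                   ∀ M → Reachable M → ¬ InConflict G M

    StructuralConflictNet : Set ℓ
    StructuralConflictNet = ∀ t u → (∃ λ M → Reachable M × Enables M (⁅ t ⁆ +ᴹ ⁅ u ⁆)) →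
                            Empty ((•ᵗ t) ∩ᴹ (•ᵗ u))

  ----------------------------------------------------------------------
  -- Processes

  module _ {ℓ} {N : Net ℓ} where
    private module N = Net N

    record LabelledPreNet : Set (lsuc ℓ) where
      field
        preNet : PreNet ℓ
      open PreNet preNet public
      field
        πˢ : Place → N.Place
        πᵗ : Transition → N.Transition

      record IsProcess : Set ℓ where
        field
          isNet             : IsNet
          pre-≤1            : ∀ s → AtMostOne (•ˢ s)
          post-≤1           : ∀ s → AtMostOne (s ˢ•)
          initially-marked  : ∀ s → Empty (•ˢ s) → M₀ s ≡ 1
          initially-empty   : ∀ s → ¬ Empty (•ˢ s) → M₀ s ≡ 0
          acyclic           : ∀ x → ¬ F⁺ x x
          finite-past       : ∀ u → FiniteSet λ t → F⁺ (inj₂ t) (inj₂ u)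
          π-M₀              : ∀ s → ∣ preimage πˢ s ∩ᴹ M₀ ∣≡ N.M₀ s
          π-pre             : ∀ t s → ∣ preimage πˢ s ∩ᴹ (•ᵗ t) ∣≡ N.Fˢᵗ s (πᵗ t)
          π-post            : ∀ t s → ∣ preimage πˢ s ∩ᴹ (t ᵗ•) ∣≡ N.Fᵗˢ (πᵗ t) s

    private module L = LabelledPreNet

    infix 4 _≅_

    record _≅_ (P P′ : LabelledPreNet) : Set ℓ where
      field
        φˢ : L.Place P ↔ L.Place P′
        φᵗ : L.Transition P ↔ L.Transition P′
      module φˢ = Inverse φˢ
      module φᵗ = Inverse φᵗ
      field
        preserves-M₀  : ∀ s → L.M₀ P′ (φˢ.to s) ≡ L.M₀ P s
        preserves-Fˢᵗ : ∀ s t → L.Fˢᵗ P′ (φˢ.to s) (φᵗ.to t) ≡ L.Fˢᵗ P s t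
        preserves-Fᵗˢ : ∀ t s → L.Fᵗˢ P′ (φᵗ.to t) (φˢ.to s) ≡ L.Fᵗˢ P t s
        preserves-πˢ  : ∀ s → L.πˢ P s ≡ L.πˢ P′ (φˢ.to s)
        preserves-πᵗ  : ∀ t → L.πᵗ P t ≡ L.πᵗ P′ (φᵗ.to t)

    swap : (P : LabelledPreNet) → L.Place P → L.Place P → LabelledPreNet
    swap P p q = record P { preNet = record (L.preNet P) { Fˢᵗ = F′ } }
      where
      F′ : L.Place P → L.Transition P → ℕ
      F′ x y = if does (em {P = x ≡ p}) then L.Fˢᵗ P q y
               else if does (em {P = x ≡ q}) then L.Fˢᵗ P p y
               else L.Fˢᵗ P x y

  record Process {ℓ} (N : Net ℓ) : Set (lsuc ℓ) where
    field
      labelledPreNet : LabelledPreNet {N = N}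
    open LabelledPreNet labelledPreNet public
    field
      isProcess : IsProcess

  module _ {ℓ} {N : Net ℓ} where
    private module P = Process

    FiniteProcess : Process N → Set ℓ
    FiniteProcess P = ∃ λ (ts : List (P.Transition P)) → ∀ t → t ∈ ts

    infix 4 _≤ᴾ_ _≡₁_ _≡₁*_ _⊑₁∞_

    -- The inclusions of the places and transitions of the prefix are
    -- rendered as injections.  The two conditions on M₀ together say that the
    -- initial markings agree up to elements of multiplicity 0.
    record _≤ᴾ_ (P′ P : Process N) : Set ℓ where
      field
        ιˢ : P.Place P′ → P.Place P
        ιᵗ : P.Transition P′ → P.Transition P
        ιˢ-injective : Injective _≡_ _≡_ ιˢ
        ιᵗ-injective : Injective _≡_ _≡_ ιᵗ
        M₀-restricts : ∀ s → P.M₀ P′ s ≡ P.M₀ P (ιˢ s)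
        M₀-covered   : ∀ s → s ∈ᴹ P.M₀ P → ∃ λ s′ → ιˢ s′ ≡ s
        Fˢᵗ-restricts : ∀ s t → P.Fˢᵗ P′ s t ≡ P.Fˢᵗ P (ιˢ s) (ιᵗ t)
        Fᵗˢ-restricts : ∀ t s → P.Fᵗˢ P′ t s ≡ P.Fᵗˢ P (ιᵗ t) (ιˢ s)
        πˢ-restricts : ∀ s → P.πˢ P′ s ≡ P.πˢ P (ιˢ s)
        πᵗ-restricts : ∀ t → P.πᵗ P′ t ≡ P.πᵗ P (ιᵗ t)

    _≡₁_ : Rel (Process N) ℓ
    P ≡₁ Q = ∃₂ λ (p q : P.Place P) →
      ¬ P.F⁺ P (inj₁ p) (inj₁ q) ×
      ¬ P.F⁺ P (inj₁ q) (inj₁ p) ×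
      P.πˢ P p ≡ P.πˢ P q ×
      swap (P.labelledPreNet P) p q ≅ P.labelledPreNet Q

    _≡₁*_ : Rel (Process N) (lsuc ℓ)
    _≡₁*_ = Star _≡₁_

    _⊑₁∞_ : Rel (Process N) (lsuc ℓ)
    P ⊑₁∞ Q = ∀ P″ → FiniteProcess P″ → P″ ≤ᴾ P →
      ∃₂ λ P′ Q′ → FiniteProcess P′ × FiniteProcess Q′ ×
        P″ ≤ᴾ P′ × P′ ≡₁* Q′ × Q′ ≤ᴾ Q

  -- BD-processes are ordered through arbitrary representatives, hence a
  -- largest one is the class of a GR-process above all GR-processes.
  HasLargestBDProcess : ∀ {ℓ} → Net ℓ → Set (lsuc ℓ)
  HasLargestBDProcess N = ∃ λ (P : Process N) → ∀ (Q : Process N) → Q ⊑₁∞ P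

{-# OPTIONS --safe #-}
module Submission where

-- Fix a place s of N and call a transition of a process a consumer if its label
-- takes tokens from s.  In a structural conflict net any two consumers are
-- causally ordered: otherwise the causal past of both could be fired, enabling
-- the two labels concurrently in spite of the common preplace s.  So each
-- consumer has a rank, the number of consumers below it, and determines it
-- within a process.  Prefixes preserve ranks because they are causally closed.
-- Swapping p and q does too: if a < b but b < a after the swap, then the path
-- from b to a jumps once between p and q, say b < p and q < a, whence
-- q < a < b < p.
--
-- If t ≠ u are both enabled in a reachable marking and share the preplace s,
-- then one firing sequence continued by t and by u yields two finite processes
-- whose last transitions have the same rank.  Both ranks are inherited by a
-- largest process, where they belong to one transition labelled t and u.  In
-- the absence of such t and u every place feeds at most one element of a
-- conflict multiset, which therefore is enabled.

open import Axiom.ExcludedMiddle using (ExcludedMiddle)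
open import Algebra.Properties.CommutativeMonoid.Sum using (sum)
open import Data.Empty using (⊥; ⊥-elim)
open import Data.Fin.Base as Fin using (Fin; zero; suc; toℕ; fromℕ; fromℕ<; splitAt; _↑ˡ_; _↑ʳ_)
open import Data.Fin.Properties as Fin using (toℕ-injective; toℕ-fromℕ; toℕ-fromℕ<; toℕ<n; injective⇒≤)
open import Data.List.Base as List
  using (List; []; _∷_; _++_; _∷ʳ_; allFin; concatMap; filter; length; lookup; tabulate)
open import Data.List.Membership.Propositional using (_∈_; _∉_; lose)
open import Data.List.Membership.Propositional.Properties
  using (∈-lookup; ∈-filter⁻; ∈-++⁺ˡ; ∈-++⁺ʳ; ∈-++⁻; ∈-∃++; ∈-map⁺; ∈-map⁻; ∈-concatMap⁺; ∈-allFin)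
open import Data.List.Properties using (length-++; length-map; length-tabulate)
open import Data.List.Relation.Unary.All as All using (All; []; _∷_)
import Data.List.Relation.Unary.All.Properties as All
open import Data.List.Relation.Unary.AllPairs using ([]; _∷_)
open import Data.List.Relation.Unary.Any using (here; there)
open import Data.List.Relation.Unary.Unique.Propositional using (Unique)
import Data.List.Relation.Unary.Unique.Propositional.Properties as Unique
open import Data.Nat.Base using (ℕ; zero; suc; _+_; _∸_; _⊓_; _≤_; _<_; z≤n; s≤s; s≤s⁻¹)
open import Data.Nat.Properties
open import Data.Nat.Solver using (module +-*-Solver)
open import Data.Product.Base using (Σ; _×_; _,_; proj₁; proj₂; ∃; ∃₂)
open import Data.Sum.Base as Sum using (_⊎_; inj₁; inj₂; [_,_])
open import Function.Base using (_∘_; id)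
open import Function.Bundles using (Injection; Inverse; mk↔ₛ′)
open import Function.Definitions using (Injective)
open import Function.Properties.Inverse using (↔⇒↣; ↔-sym)
open import Induction.WellFounded using (Acc; acc)
open import Level using (Lift; lift; lower)
open import Relation.Binary.Construct.Closure.ReflexiveTransitive using (ε; _◅_)
open import Relation.Binary.Construct.Closure.Transitive using (_∷_)
  renaming ([_] to [_]⁺; _++_ to _⁺++_; _∷ʳ_ to _⁺∷ʳ_)
open import Relation.Binary.Core using (Rel)
open import Relation.Binary.Definitions using (tri<; tri≈; tri>)
open import Relation.Binary.PropositionalEquality hiding ([_])
open import Relation.Nullary.Decidable.Core using (yes; no)
open import Relation.Nullary.Negation.Core using (¬_; contradiction)
open import Relation.Unary using (Pred; Decidable)
open import Relation.Unary.Properties using (∁?)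
open import Defs

-- Multisets

Fin1-irrelevant : (i j : Fin 1) → i ≡ j
Fin1-irrelevant zero zero = refl

module _ {a} {X : Set a} where

  copy-≡ : {A : Multiset X} → (∀ x → A x ≤ 1) →
           {c d : Copies A} → proj₁ c ≡ proj₁ d → c ≡ d
  copy-≡ {A} A≤1 {x , i} {_ , j} refl = cong (x ,_) (go (A≤1 x) i j)
    where
    go : ∀ {n} → n ≤ 1 → (i j : Fin n) → i ≡ j
    go (s≤s z≤n) zero zero = refl

  copy-of : {A : Multiset X} → ∀ {x} → x ∈ᴹ A → Copies A
  copy-of {x = x} x∈A = x , fromℕ< x∈A

  copy-∈ : {A : Multiset X} (c : Copies A) → proj₁ c ∈ᴹ A
  copy-∈ (_ , i) = ≤-<-trans z≤n (toℕ<n i)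

  ∣∣≡-from : ∀ {A : Multiset X} {n} (g : Fin n → Copies A) → Injective _≡_ _≡_ g →
             (∀ c → ∃ λ i → g i ≡ c) → ∣ A ∣≡ n
  ∣∣≡-from g g-injective g-surjective =
    mk↔ₛ′ (proj₁ ∘ g-surjective) g
          (λ i → g-injective (proj₂ (g-surjective (g i))))
          (proj₂ ∘ g-surjective)

  ∣∣≡-enumeration : ∀ {A : Multiset X} {n} (f : Fin n → X) → (∀ x → A x ≤ 1) →
                    Injective _≡_ _≡_ f → (∀ i → f i ∈ᴹ A) →
                    (∀ x → x ∈ᴹ A → ∃ λ i → f i ≡ x) → ∣ A ∣≡ n
  ∣∣≡-enumeration f A≤1 f-injective f∈A f-surjective =
    ∣∣≡-from (λ i → copy-of (f∈A i)) (f-injective ∘ cong proj₁)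
      (λ c → let i , eq = f-surjective (proj₁ c) (copy-∈ c) in i , copy-≡ A≤1 eq)

  ∣∣≡-to-injective : ∀ {A : Multiset X} {n} (e : ∣ A ∣≡ n) →
                     Injective _≡_ _≡_ (Inverse.to e)
  ∣∣≡-to-injective e = Injection.injective (↔⇒↣ e)

  ∣∣≡-from-injective : ∀ {A : Multiset X} {n} (e : ∣ A ∣≡ n) →
                       Injective _≡_ _≡_ (Inverse.from e)
  ∣∣≡-from-injective e = Injection.injective (↔⇒↣ (↔-sym e))

  lookup-injective : ∀ {xs : List X} → Unique xs → Injective _≡_ _≡_ (lookup xs)
  lookup-injective (_  ∷ _)   {zero}  {zero}  _  = refl
  lookup-injective (x∉ ∷ _)   {zero}  {suc j} eq = contradiction eq (All.lookup x∉ (∈-lookup j))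
  lookup-injective (x∉ ∷ _)   {suc i} {zero}  eq = contradiction (sym eq) (All.lookup x∉ (∈-lookup i))
  lookup-injective (_  ∷ xs!) {suc i} {suc j} eq = cong suc (lookup-injective xs! eq)

  -- Representing each entry by its copy of index 0 embeds the positions of the list into `Fin n`.
  unique-length-≤ : ∀ {A : Multiset X} {n xs} → ∣ A ∣≡ n →
                    Unique xs → All (_∈ᴹ A) xs → length xs ≤ n
  unique-length-≤ {A} {xs = xs} e xs! xs⊆A =
    injective⇒≤ {f = λ i → Inverse.to e (copy-of (All.lookup xs⊆A (∈-lookup {xs = xs} i)))}
      (lookup-injective xs! ∘ cong proj₁ ∘ ∣∣≡-to-injective e)

  ∣∣≡⇒list : ∀ {A : Multiset X} {n} → ∣ A ∣≡ n → (∀ x → A x ≤ 1) →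
             ∃ λ xs → length xs ≡ n × Unique xs × All (_∈ᴹ A) xs
  ∣∣≡⇒list {A} {n} e A≤1 =
    tabulate f , length-tabulate f ,
    Unique.tabulate⁺ (∣∣≡-from-injective e ∘ copy-≡ A≤1) ,
    All.tabulate⁺ (copy-∈ ∘ Inverse.from e)
    where
    f : Fin n → X
    f = proj₁ ∘ Inverse.from e

  AtMostOne⇒≡ : ∀ {A : Multiset X} → AtMostOne A → ∀ {x y} → x ∈ᴹ A → y ∈ᴹ A → x ≡ y
  AtMostOne⇒≡ (_ , s≤s z≤n , e) x∈A y∈A =
    cong proj₁ (∣∣≡-to-injective e {copy-of x∈A} {copy-of y∈A} (Fin1-irrelevant _ _))
  AtMostOne⇒≡ (_ , z≤n , e) x∈A _ with () ← Inverse.to e (copy-of x∈A)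

  ¬NonEmpty⇒Empty : ∀ {A : Multiset X} → ¬ NonEmpty A → Empty A
  ¬NonEmpty⇒Empty ∄ x = n≤0⇒n≡0 (≮⇒≥ λ x∈A → ∄ (x , x∈A))

  ∈-∩⁺ : ∀ (A B : Multiset X) {x} → x ∈ᴹ A → x ∈ᴹ B → x ∈ᴹ A ∩ᴹ B
  ∈-∩⁺ A B = ⊓-glb

  ∈-∩⁻ : ∀ (A B : Multiset X) {x} → x ∈ᴹ A ∩ᴹ B → x ∈ᴹ A × x ∈ᴹ B
  ∈-∩⁻ A B {x} x∈ = <-≤-trans x∈ (m⊓n≤m (A x) (B x)) , <-≤-trans x∈ (m⊓n≤n (A x) (B x))

  +ᴹ-finite : ∀ {A B : Multiset X} {m n} → ∣ A ∣≡ m → ∣ B ∣≡ n → ∣ A +ᴹ B ∣≡ (m + n)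
  +ᴹ-finite {A} {B} {m} {n} eA eB = mk↔ₛ′ (Fin.join m n ∘ h) (g ∘ splitAt m)
    (λ i → trans (cong (Fin.join m n) (h∘g (splitAt m i))) (Fin.join-splitAt m n i))
    (λ c → trans (cong g (Fin.splitAt-join m n (h c))) (g∘h c))
    where
    g : Fin m ⊎ Fin n → Copies (A +ᴹ B)
    g (inj₁ i) = let x , k = Inverse.from eA i in x , k ↑ˡ B x
    g (inj₂ i) = let x , k = Inverse.from eB i in x , A x ↑ʳ k

    h : Copies (A +ᴹ B) → Fin m ⊎ Fin n
    h (x , k) = Sum.map (Inverse.to eA ∘ (x ,_)) (Inverse.to eB ∘ (x ,_)) (splitAt (A x) k)

    h∘g : ∀ v → h (g v) ≡ v
    h∘g (inj₁ i) = let x , k = Inverse.from eA i in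
      trans (cong (Sum.map _ _) (Fin.splitAt-↑ˡ (A x) k (B x)))
            (cong inj₁ (Inverse.strictlyInverseˡ eA i))
    h∘g (inj₂ i) = let x , k = Inverse.from eB i in
      trans (cong (Sum.map _ _) (Fin.splitAt-↑ʳ (A x) (B x) k))
            (cong inj₂ (Inverse.strictlyInverseˡ eB i))

    g∘h : ∀ c → g (h c) ≡ c
    g∘h (x , k) with splitAt (A x) k in eq
    ... | inj₁ i = trans (cong (λ (y , l) → y , l ↑ˡ B y) (Inverse.strictlyInverseʳ eA (x , i)))
                         (cong (x ,_) (Fin.splitAt⁻¹-↑ˡ eq))
    ... | inj₂ i = trans (cong (λ (y , l) → y , A y ↑ʳ l) (Inverse.strictlyInverseʳ eB (x , i)))
                         (cong (x ,_) (Fin.splitAt⁻¹-↑ʳ eq))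

-- Finite sums of natural numbers.

sumℕ : ∀ {n} → (Fin n → ℕ) → ℕ
sumℕ {n} = sum +-0-commutativeMonoid {n}

term≤sum : ∀ {n} (t : Fin n → ℕ) i → t i ≤ sumℕ t
term≤sum t zero    = m≤m+n _ _
term≤sum t (suc i) = ≤-trans (term≤sum (t ∘ suc) i) (m≤n+m _ (t zero))

terms≤sum : ∀ {n} (t : Fin n → ℕ) {i j} → i ≢ j → t i + t j ≤ sumℕ t
terms≤sum t {zero}  {zero}  i≢j = contradiction refl i≢j
terms≤sum t {zero}  {suc j} i≢j = +-monoʳ-≤ (t zero) (term≤sum (t ∘ suc) j)
terms≤sum t {suc i} {zero}  i≢j =
  subst (_≤ sumℕ t) (+-comm (t zero) _) (+-monoʳ-≤ (t zero) (term≤sum (t ∘ suc) i))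
terms≤sum t {suc i} {suc j} i≢j =
  ≤-trans (terms≤sum (t ∘ suc) (i≢j ∘ cong suc)) (m≤n+m _ (t zero))

-- A positive head forces every later term to vanish, so the induction hypothesis bounds the tail by
-- 0. The terms will be the demands that the copies in a multiset of transitions place on one place.
sum≤ : ∀ {n b} (t : Fin n → ℕ) → (∀ i → t i ≤ b) →
       (∀ {i j} → i ≢ j → 0 < t i → 0 < t j → ⊥) → sumℕ t ≤ b
sum≤ {zero}      t t≤b single = z≤n
sum≤ {suc n} {b} t t≤b single with t zero in eq
... | zero  = sum≤ (t ∘ suc) (t≤b ∘ suc) (λ i≢j → single (i≢j ∘ Fin.suc-injective))
... | suc k = subst (suc k + sumℕ (t ∘ suc) ≤_) (+-identityʳ b)
  (+-mono-≤ (subst (_≤ b) eq (t≤b zero))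
    (sum≤ (t ∘ suc)
      (λ i → ≮⇒≥ λ 0<ti → single {zero} {suc i} (λ ()) (subst (0 <_) (sym eq) (s≤s z≤n)) 0<ti)
      (λ i≢j → single (i≢j ∘ Fin.suc-injective))))

-- Characteristic functions and singletons.

module _ (em : ∀ {a} → ExcludedMiddle a) {a} {X : Set a} where

  module _ {p} (P : Pred X p) where

    char-≤1 : ∀ x → char em P x ≤ 1
    char-≤1 x with em {P = P x}
    ... | yes _ = ≤-refl
    ... | no  _ = z≤n

    char-∈⁺ : ∀ {x} → P x → x ∈ᴹ char em P
    char-∈⁺ {x} px with em {P = P x}
    ... | yes _  = ≤-refl
    ... | no ¬px = contradiction px ¬px

    char-∈⁻ : ∀ {x} → x ∈ᴹ char em P → P x
    char-∈⁻ {x} x∈ with em {P = P x}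
    char-∈⁻ x∈ | yes px = px
    char-∈⁻ () | no _

    char-yes : ∀ {x} → P x → char em P x ≡ 1
    char-yes px = ≤-antisym (char-≤1 _) (char-∈⁺ px)

    char-no : ∀ {x} → ¬ P x → char em P x ≡ 0
    char-no ¬px = n≤0⇒n≡0 (≮⇒≥ (¬px ∘ char-∈⁻))

  AtMostOne⁺ : ∀ {A : Multiset X} → (∀ x → A x ≤ 1) →
               (∀ {x y} → x ∈ᴹ A → y ∈ᴹ A → x ≡ y) → AtMostOne A
  AtMostOne⁺ {A} A≤1 A-unique with em {P = ∃ λ x → x ∈ᴹ A}
  ... | yes (x , x∈A) = 1 , ≤-refl ,
        ∣∣≡-enumeration (λ _ → x) A≤1 (λ {i} {j} _ → Fin1-irrelevant i j) (λ _ → x∈A)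
          (λ y y∈A → zero , A-unique x∈A y∈A)
  ... | no ∄ = 0 , z≤n ,
        ∣∣≡-enumeration (λ ()) A≤1 (λ { {()} }) (λ ()) (λ x x∈A → contradiction (x , x∈A) ∄)

  ∣⁅⁆∣≡1 : ∀ (t : X) → ∣ ⁅_⁆ em t ∣≡ 1
  ∣⁅⁆∣≡1 t = ∣∣≡-enumeration (λ _ → t) (char-≤1 (_≡ t)) (λ {i} {j} _ → Fin1-irrelevant i j)
    (λ _ → char-∈⁺ (_≡ t) refl) (λ x x∈ → zero , sym (char-∈⁻ (_≡ t) x∈))

  -- The size in `fin` is an arbitrary witness. Size zero would miss the copy of `t`, and from size
  -- two on two indices would name the same copy.
  linearExtension-⁅⁆ : ∀ {b} {Y : Set b} (f : X → Multiset Y) (t : X) (fin : FiniteMultiset (⁅_⁆ em t)) →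
                       ∀ y → linearExtension f (⁅_⁆ em t) fin y ≡ f t y
  linearExtension-⁅⁆ f t (zero , e) y with () ← Inverse.to e (copy-of (char-∈⁺ (_≡ t) refl))
  linearExtension-⁅⁆ f t (suc zero , e) y =
    trans (+-identityʳ _) (cong (λ x → f x y) (char-∈⁻ (_≡ t) (copy-∈ (Inverse.from e zero))))
  linearExtension-⁅⁆ f t (suc (suc n) , e) y =
    contradiction
      (∣∣≡-from-injective e {zero} {suc zero}
        (copy-≡ (char-≤1 (_≡ t)) (trans (elem zero) (sym (elem (suc zero))))))
      (λ ())
    where
    elem : ∀ i → proj₁ (Inverse.from e i) ≡ t
    elem i = char-∈⁻ (_≡ t) (copy-∈ (Inverse.from e i))

-- Firing and conflict

module _ (em : ∀ {a} → ExcludedMiddle a) {ℓ} (N : Net ℓ) where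
  open Net N

  fire : Marking → Transition → Marking
  fire M t = (M -ᴹ (•ᵗ t)) +ᴹ (t ᵗ•)

  singleStep⁺ : ∀ {M t} → (•ᵗ t) ⊆ᴹ M → Step em N M (⁅_⁆ em t) (fire M t)
  singleStep⁺ {M} {t} •t⊆M = record
    { finite   = fin
    ; nonempty = t , char-∈⁺ em (_≡ t) refl
    ; enabled  = λ s → subst (_≤ M s) (sym (pre s)) (•t⊆M s)
    ; result   = λ s → sym (cong₂ (λ m n → M s ∸ m + n) (pre s) (linearExtension-⁅⁆ em _ᵗ• t fin s))
    }
    where
    fin : FiniteMultiset (⁅_⁆ em t)
    fin = 1 , ∣⁅⁆∣≡1 em t
    pre : ∀ s → linearExtension •ᵗ_ (⁅_⁆ em t) fin s ≡ Fˢᵗ s t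
    pre = linearExtension-⁅⁆ em •ᵗ_ t fin

  singleStep⁻ : ∀ {M t M′} → Step em N M (⁅_⁆ em t) M′ → (•ᵗ t) ⊆ᴹ M × M′ ≗ fire M t
  singleStep⁻ {M} {t} step =
    (λ s → subst (_≤ M s) (pre s) (enabled s)) ,
    (λ s → trans (result s) (cong₂ (λ m n → M s ∸ m + n) (pre s) (linearExtension-⁅⁆ em _ᵗ• t finite s)))
    where
    open Step step
    pre : ∀ s → linearExtension •ᵗ_ (⁅_⁆ em t) finite s ≡ Fˢᵗ s t
    pre = linearExtension-⁅⁆ em •ᵗ_ t finite

  fires-snoc : ∀ {M σ M₁ t} → Fires em N M σ M₁ → (•ᵗ t) ⊆ᴹ M₁ →
               Fires em N M (σ ∷ʳ t) (fire M₁ t)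
  fires-snoc {t = t} ([] M₁≗M) •t⊆M₁ =
    singleStep⁺ (λ s → subst (Fˢᵗ s t ≤_) (M₁≗M s) (•t⊆M₁ s)) ∷
    -- Markings agree only pointwise; the empty sequence absorbs the difference between `fire M t`
    -- and `fire M₁ t`.
    [] (λ s → cong (λ m → m ∸ Fˢᵗ s t + Fᵗˢ t s) (M₁≗M s))
  fires-snoc (step ∷ fires) •t⊆M₁ = step ∷ fires-snoc fires •t⊆M₁

  reachable-fire : ∀ {M t} → Reachable em N M → (•ᵗ t) ⊆ᴹ M → Reachable em N (fire M t)
  reachable-fire (σ , fires) •t⊆M = σ ∷ʳ _ , fires-snoc fires •t⊆M

  pair-enabled : ∀ {M t u} → ((•ᵗ t) +ᴹ (•ᵗ u)) ⊆ᴹ M → Enables em N M (⁅_⁆ em t +ᴹ ⁅_⁆ em u)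
  pair-enabled {M} {t} {u} •tu⊆M = _ , record
    { finite   = 2 , +ᴹ-finite (∣⁅⁆∣≡1 em t) (∣⁅⁆∣≡1 em u)
    ; nonempty = t , <-≤-trans (char-∈⁺ em (_≡ t) refl) (m≤m+n _ _)
    ; enabled  = λ s → subst (_≤ M s) (cong (Fˢᵗ s t +_) (sym (+-identityʳ _))) (•tu⊆M s)
    ; result   = λ _ → refl
    }

  structural⇒disjoint : StructuralConflictNet em N →
                        ∀ {M t u s} → Reachable em N M → ((•ᵗ t) +ᴹ (•ᵗ u)) ⊆ᴹ M →
                        0 < Fˢᵗ s t → 0 < Fˢᵗ s u → ⊥
  structural⇒disjoint struct {M} {t} {u} {s} reach •tu⊆M 0<st 0<su =
    <-irrefl (sym (struct t u (M , reach , pair-enabled •tu⊆M) s)) (⊓-glb 0<st 0<su)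

  ↾-∈ : ∀ {G : Multiset Transition} {t} → (_↾_ em G t) t ≡ G t
  ↾-∈ {G} {t} with em {P = t ≡ t}
  ... | yes _  = refl
  ... | no t≢t = contradiction refl t≢t

  -- The demand of one copy of `t` is a single term of the demand of the whole restriction.
  ↾-enabled : ∀ {M G t} → t ∈ᴹ G → Enables em N M (_↾_ em G t) → (•ᵗ t) ⊆ᴹ M
  ↾-enabled {M} {G} {t} t∈G (_ , step) s =
    ≤-trans
      (subst (λ (u , _) → Fˢᵗ s u ≤ sumℕ pre) (Inverse.strictlyInverseʳ e copy)
        (term≤sum pre (Inverse.to e copy)))
      (enabled s)
    where
    open Step step
    e = proj₂ finite
    copy : Copies (_↾_ em G t)
    copy = copy-of (subst (0 <_) (sym (↾-∈ {G})) t∈G)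
    pre : Fin (proj₁ finite) → ℕ
    pre i = Fˢᵗ s (proj₁ (Inverse.from e i))

  -- Two different copies contribute two terms of the sum. Thus a repeated transition counts as
  -- concurrent with itself, and the structural condition applies to it.
  ↾-enabled-twice : ∀ {M G t} → 1 < G t → Enables em N M (_↾_ em G t) → ((•ᵗ t) +ᴹ (•ᵗ t)) ⊆ᴹ M
  ↾-enabled-twice {M} {G} {t} 1<Gt (_ , step) s =
    ≤-trans
      (subst₂ (λ (u , _) (v , _) → Fˢᵗ s u + Fˢᵗ s v ≤ sumℕ pre)
        (Inverse.strictlyInverseʳ e _) (Inverse.strictlyInverseʳ e _)
        (terms≤sum pre {Inverse.to e (t , fromℕ< 0<n)} {Inverse.to e (t , fromℕ< 1<n)}
          (distinct ∘ ∣∣≡-to-injective e)))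
      (enabled s)
    where
    open Step step
    e = proj₂ finite
    1<n : 1 < (_↾_ em G t) t
    1<n = subst (1 <_) (sym (↾-∈ {G})) 1<Gt
    0<n : 0 < (_↾_ em G t) t
    0<n = <-trans (s≤s z≤n) 1<n
    distinct′ : ∀ {n} (p : 0 < n) (q : 1 < n) → fromℕ< p ≢ fromℕ< q
    distinct′ p q eq with () ← Fin.fromℕ<-injective 0 1 p q eq
    distinct : _≢_ {A = Copies (_↾_ em G t)} (t , fromℕ< 0<n) (t , fromℕ< 1<n)
    distinct eq = distinct′ 0<n 1<n (go eq)
      where
      go : ∀ {i j} → _≡_ {A = Copies (_↾_ em G t)} (t , i) (t , j) → i ≡ j
      go refl = refl
    pre : Fin (proj₁ finite) → ℕ
    pre i = Fˢᵗ s (proj₁ (Inverse.from e i))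

  distinct-copies : ∀ {A : Multiset Transition} {t} {i j : Fin (A t)} → i ≢ j → 1 < A t
  distinct-copies {A} {t} = go
    where
    go : ∀ {n} {i j : Fin n} → i ≢ j → 1 < n
    go {suc zero}    {i} {j} i≢j = contradiction (Fin1-irrelevant i j) i≢j
    go {suc (suc n)} i≢j = s≤s (s≤s z≤n)

  -- A place feeds at most one copy in G.
  no-binary-conflict⇒no-conflict :
    StructuralConflictNet em N → ∀ {M G} → Reachable em N M → FiniteMultiset G → NonEmpty G →
    (∀ {t u s} → t ≢ u → (•ᵗ t) ⊆ᴹ M → (•ᵗ u) ⊆ᴹ M → 0 < Fˢᵗ s t → 0 < Fˢᵗ s u → ⊥) →
    ¬ InConflict em N G M
  no-binary-conflict⇒no-conflict struct {M} {G} reach (n , e) nonempty no-binary (¬enabled , enabled) =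
    ¬enabled (_ , record
      { finite   = n , e
      ; nonempty = nonempty
      ; enabled  = λ s → sum≤ (λ i → Fˢᵗ s (proj₁ (Inverse.from e i)))
          (λ i → single (Inverse.from e i) s)
          (λ i≢j → disjoint (i≢j ∘ ∣∣≡-from-injective e))
      ; result   = λ _ → refl
      })
    where
    single : ∀ (c : Copies G) → (•ᵗ (proj₁ c)) ⊆ᴹ M
    single c = ↾-enabled (copy-∈ c) (enabled _ (copy-∈ c))

    disjoint : ∀ {c d : Copies G} {s} → c ≢ d → 0 < Fˢᵗ s (proj₁ c) → 0 < Fˢᵗ s (proj₁ d) → ⊥
    disjoint {c@(t , i)} {d@(u , j)} c≢d with em {P = t ≡ u}
    ... | no t≢u   = no-binary t≢u (single c) (single d)
    ... | yes refl = structural⇒disjoint struct reach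
          (↾-enabled-twice (distinct-copies {G} (c≢d ∘ cong (t ,_))) (enabled t (copy-∈ c)))

-- Causal order and concurrency

module _ {a r} {X : Set a} {_≺_ : Rel X r} where

  -- Induction on the length of a list covering the past. On passing to `y ≺ x`, transitivity keeps
  -- the list valid, and irreflexivity lets one occurrence of `y` be deleted.
  finite-past⇒acc : (∀ {x y z} → x ≺ y → y ≺ z → x ≺ z) → (∀ {x} → ¬ x ≺ x) →
                    ∀ {x} → FiniteSet (_≺ x) → Acc _≺_ x
  finite-past⇒acc ≺-trans ≺-irrefl (xs , past⊆xs) = go (length xs) xs ≤-refl past⊆xs
    where
    go : ∀ n xs → length xs ≤ n → ∀ {x} → (∀ {y} → y ≺ x → y ∈ xs) → Acc _≺_ x
    go zero    []       _ past = acc λ y≺x → contradiction (past y≺x) λ ()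
    go (suc n) xs ∣xs∣≤n past = acc smaller
      where
      smaller : ∀ {y} → y ≺ _ → Acc _≺_ y
      smaller {y} y≺x with ∈-∃++ (past y≺x)
      ... | ys , zs , refl = go n (ys ++ zs) shorter λ z≺y → remove z≺y (∈-++⁻ ys (past (≺-trans z≺y y≺x)))
        where
        shorter : length (ys ++ zs) ≤ n
        shorter = s≤s⁻¹ (subst (_≤ suc n)
          (trans (length-++ ys) (trans (+-suc _ _) (cong suc (sym (length-++ ys))))) ∣xs∣≤n)
        remove : ∀ {z} → z ≺ y → z ∈ ys ⊎ z ∈ y ∷ zs → z ∈ ys ++ zs
        remove z≺y (inj₁ z∈ys)         = ∈-++⁺ˡ z∈ys
        remove z≺y (inj₂ (here refl))  = contradiction z≺y ≺-irrefl
        remove z≺y (inj₂ (there z∈zs)) = ∈-++⁺ʳ ys z∈zs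

length-filter-∁ : ∀ {a p} {X : Set a} {P : Pred X p} (P? : Decidable P) xs →
                  length xs ≡ length (filter P? xs) + length (filter (∁? P?) xs)
length-filter-∁ P? [] = refl
length-filter-∁ P? (x ∷ xs) with P? x
... | yes _ = cong suc (length-filter-∁ P? xs)
... | no  _ = trans (cong suc (length-filter-∁ P? xs)) (sym (+-suc _ _))

-- Runs of a process and the firing of their labels.

module _ {em : ∀ {a} → ExcludedMiddle a} {ℓ} {N : Net ℓ} (P : Process em N) where
  open Process P
  open IsProcess isProcess
  private module N = Net N

  infix 4 _<ᵗ_

  _<ᵗ_ : Rel Transition ℓ
  t <ᵗ u = F⁺ (inj₂ t) (inj₂ u)

  <ᵗ-irrefl : ∀ {x} → ¬ x <ᵗ x
  <ᵗ-irrefl = acyclic _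

  preset-list : ∀ t s → ∃ λ ps → length ps ≡ N.Fˢᵗ s (πᵗ t) × Unique ps ×
                                 All (λ p → πˢ p ≡ s × 0 < Fˢᵗ p t) ps
  preset-list t s =
    let ps , ∣ps∣ , ps! , ps∈ = ∣∣≡⇒list (π-pre t s)
          (λ p → ≤-trans (m⊓n≤m _ _) (char-≤1 em (λ q → πˢ q ≡ s) p))
    in ps , ∣ps∣ , ps! , All.map (λ p∈ → let p∈π , p∈• = ∈-∩⁻ (preimage em πˢ s) (•ᵗ t) p∈
                                         in char-∈⁻ em (λ q → πˢ q ≡ s) p∈π , p∈•) ps∈

  -- The places that hold a token once exactly the transitions in `X` have occurred.
  Cut : List Transition → Pred Place ℓ
  Cut X p = (p ∈ᴹ M₀ ⊎ ∃ λ z → z ∈ X × 0 < Fᵗˢ z p) × (∀ {z} → z ∈ X → ¬ 0 < Fˢᵗ p z)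

  Past⊆ : Transition → Pred (List Transition) ℓ
  Past⊆ x X = ∀ {z} → z <ᵗ x → z ∈ X

  -- Linearisations of finite causally closed sets, latest transition first, with the marking of `N`
  -- that the labels lead to. Enabledness is not a premise: `run-enabled` derives it from causal
  -- closure.
  data Run : List Transition → N.Marking → Set ℓ where
    start : Run [] N.M₀
    step  : ∀ {X M x} → Run X M → x ∉ X → Past⊆ x X → Run (x ∷ X) (fire em N M (πᵗ x))

  -- A preplace of `x` is initial or has a producer, which lies in the past of `x`. Its only
  -- consumer is `x` itself, which has not occurred.
  preset⊆cut : ∀ {X x} → x ∉ X → Past⊆ x X → ∀ {p} → 0 < Fˢᵗ p x → Cut X p
  preset⊆cut {X} {x} x∉X past⊆X {p} p∈•x = marked , unconsumed
    where
    marked : p ∈ᴹ M₀ ⊎ ∃ λ z → z ∈ X × 0 < Fᵗˢ z p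
    marked with em {P = ∃ λ z → 0 < Fᵗˢ z p}
    ... | yes (z , z→p) = inj₂ (z , past⊆X (_∷_ {y = inj₁ p} z→p [ p∈•x ]⁺) , z→p)
    ... | no  ∄ = inj₁ (subst (0 <_) (sym (initially-marked p (¬NonEmpty⇒Empty ∄))) ≤-refl)

    unconsumed : ∀ {z} → z ∈ X → ¬ 0 < Fˢᵗ p z
    unconsumed z∈X p∈•z = x∉X (subst (_∈ X) (AtMostOne⇒≡ (post-≤1 p) p∈•z p∈•x) z∈X)

  -- Counting through duplicate-free lists instead of bijections leaves an
  -- inequality, which is all that is needed to fire the labels in N.
  run-capacity : ∀ {X M} → Run X M → ∀ {s ps} → Unique ps →
                 All (λ p → πˢ p ≡ s × Cut X p) ps → length ps ≤ M s
  run-capacity start {s} ps! ps∈ = unique-length-≤ (π-M₀ s) ps! (All.map initial ps∈)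
    where
    initial : ∀ {p} → πˢ p ≡ s × Cut [] p → p ∈ᴹ preimage em πˢ s ∩ᴹ M₀
    initial (π≡ , inj₁ p∈M₀ , _) = ∈-∩⁺ (preimage em πˢ s) M₀ (char-∈⁺ em (λ q → πˢ q ≡ s) π≡) p∈M₀
  run-capacity (step {X} {M} {x} run x∉X past⊆X) {s} {ps} ps! ps∈ with preset-list x s
  ... | qs , ∣qs∣ , qs! , qs∈ = begin
    length ps                                ≡⟨ length-filter-∁ new? ps ⟩
    length new + length old                  ≤⟨ +-mono-≤ new≤ old≤ ⟩
    N.Fᵗˢ (πᵗ x) s + (M s ∸ N.Fˢᵗ s (πᵗ x))  ≡⟨ +-comm (N.Fᵗˢ (πᵗ x) s) _ ⟩
    fire em N M (πᵗ x) s                     ∎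
    where
    open ≤-Reasoning
    new? : Decidable λ p → 0 < Fᵗˢ x p
    new? p = 0 <? Fᵗˢ x p

    new old : List Place
    new = filter new? ps
    old = filter (∁? new?) ps

    new≤ : length new ≤ N.Fᵗˢ (πᵗ x) s
    new≤ = unique-length-≤ (π-post x s) (Unique.filter⁺ new? ps!)
      (All.tabulate λ p∈ → let p∈ps , p∈x• = ∈-filter⁻ new? p∈ in
        ∈-∩⁺ (preimage em πˢ s) (x ᵗ•) (char-∈⁺ em (λ q → πˢ q ≡ s) (proj₁ (All.lookup ps∈ p∈ps))) p∈x•)

    remains : ∀ {p} → p ∈ old → πˢ p ≡ s × Cut X p
    remains p∈ with ∈-filter⁻ (∁? new?) p∈
    ... | p∈ps , p∉x• with All.lookup ps∈ p∈ps
    ... | π≡ , inj₁ p∈M₀ , unconsumed = π≡ , inj₁ p∈M₀ , unconsumed ∘ there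
    ... | π≡ , inj₂ (_ , here refl , p∈x•) , _ = contradiction p∈x• p∉x•
    ... | π≡ , inj₂ (z , there z∈X , z→p) , unconsumed = π≡ , inj₂ (z , z∈X , z→p) , unconsumed ∘ there

    disjoint : ∀ {p} → ¬ (p ∈ old × p ∈ qs)
    disjoint (p∈old , p∈qs) =
      proj₂ (proj₂ (All.lookup ps∈ (proj₁ (∈-filter⁻ (∁? new?) p∈old)))) (here refl)
        (proj₂ (All.lookup qs∈ p∈qs))

    -- The surviving places and the preplaces of `x` were all in the cut before `x`, and they are
    -- disjoint. The induction hypothesis for both lists together leaves room for subtracting the
    -- preset.
    old≤ : length old ≤ M s ∸ N.Fˢᵗ s (πᵗ x)
    old≤ = m+n≤o⇒m≤o∸n (length old) (subst (_≤ M s)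
      (trans (length-++ old) (cong (length old +_) ∣qs∣))
      (run-capacity run {ps = old ++ qs}
        (Unique.++⁺ (Unique.filter⁺ (∁? new?) ps!) qs! disjoint)
        (All.++⁺ (All.tabulate remains)
          (All.map (λ (π≡ , q∈•x) → π≡ , preset⊆cut x∉X past⊆X q∈•x) qs∈))))

  run-enabled : ∀ {X M x} → Run X M → x ∉ X → Past⊆ x X → (N.•ᵗ (πᵗ x)) ⊆ᴹ M
  run-enabled {M = M} {x} run x∉X past⊆X s with preset-list x s
  ... | qs , ∣qs∣ , qs! , qs∈ = subst (_≤ M s) ∣qs∣ (run-capacity run qs!
    (All.map (λ (π≡ , q∈•x) → π≡ , preset⊆cut x∉X past⊆X q∈•x) qs∈))

  run-enabled-pair : ∀ {X M x y} → Run X M → x ≢ y → x ∉ X → Past⊆ x X → y ∉ X → Past⊆ y X →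
                     ((N.•ᵗ (πᵗ x)) +ᴹ (N.•ᵗ (πᵗ y))) ⊆ᴹ M
  run-enabled-pair {M = M} {x} {y} run x≢y x∉X x-past y∉X y-past s
    with ps , ∣ps∣ , ps! , ps∈ ← preset-list x s | qs , ∣qs∣ , qs! , qs∈ ← preset-list y s =
    subst (_≤ M s) (trans (length-++ ps) (cong₂ _+_ ∣ps∣ ∣qs∣))
      (run-capacity run (Unique.++⁺ ps! qs! disjoint)
        (All.++⁺ (All.map (λ (π≡ , p∈•x) → π≡ , preset⊆cut x∉X x-past p∈•x) ps∈)
                 (All.map (λ (π≡ , q∈•y) → π≡ , preset⊆cut y∉X y-past q∈•y) qs∈)))
    where
    disjoint : ∀ {p} → ¬ (p ∈ ps × p ∈ qs)
    disjoint {p} (p∈ps , p∈qs) = x≢y (AtMostOne⇒≡ (post-≤1 p)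
      (proj₂ (All.lookup ps∈ p∈ps)) (proj₂ (All.lookup qs∈ p∈qs)))

  run-reachable : ∀ {X M} → Run X M → Reachable em N M
  run-reachable start = [] , [] λ _ → refl
  run-reachable (step run x∉X past⊆X) =
    reachable-fire em N (run-reachable run) (run-enabled run x∉X past⊆X)

  Extends : List Transition → Pred Transition ℓ → List Transition → Set ℓ
  Extends X Q X′ = (∀ {z} → z ∈ X → z ∈ X′) × (∀ {z} → z ∈ X′ → z ∈ X ⊎ Q z)

  -- A list covering a finite past may contain more than the past. Members outside `Q` are skipped,
  -- so that nothing else enters the run.
  run-list : ∀ {Q : Pred Transition ℓ} (us : List Transition) →
             (∀ {u X M} → Q u → Run X M → ∃₂ λ X′ M′ → Run X′ M′ × Extends X Q X′ × u ∈ X′) →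
             ∀ {X M} → Run X M →
             ∃₂ λ X′ M′ → Run X′ M′ × Extends X Q X′ × (∀ {u} → u ∈ us → Q u → u ∈ X′)
  run-list [] add run = _ , _ , run , (id , inj₁) , λ ()
  run-list {Q} (u ∷ us) add run with em {P = Q u}
  ... | no ¬Qu with X′ , M′ , run′ , ext , us⊆ ← run-list us add run =
    X′ , M′ , run′ , ext , λ { (here refl) Qu → contradiction Qu ¬Qu ; (there u∈) → us⊆ u∈ }
  ... | yes Qu with X₁ , M₁ , run₁ , (⊆₁ , ⊇₁) , u∈ ← add Qu run
               with X₂ , M₂ , run₂ , (⊆₂ , ⊇₂) , us⊆ ← run-list us add run₁ =
    X₂ , M₂ , run₂ , (⊆₂ ∘ ⊆₁ , [ ⊇₁ , inj₂ ] ∘ ⊇₂) ,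
    λ { (here refl) _ → ⊆₂ u∈ ; (there u∈) → us⊆ u∈ }

  -- Well-founded recursion: each missing `v` below `u` is added after its own past. That only
  -- predecessors of `u` are added keeps `u` itself, and everything unrelated to it, available for
  -- later.
  run-past : ∀ {u} → Acc _<ᵗ_ u → ∀ {X M} → Run X M →
             ∃₂ λ X′ M′ → Run X′ M′ × Extends X (_<ᵗ u) X′ × Past⊆ u X′
  run-past {u} (acc below) run =
    let us , past⊆us = finite-past u
        X′ , M′ , run′ , ext , us⊆ = run-list {_<ᵗ u} us add run
    in X′ , M′ , run′ , ext , λ z<u → us⊆ (past⊆us z<u) z<u
    where
    add : ∀ {v X M} → v <ᵗ u → Run X M → ∃₂ λ X′ M′ → Run X′ M′ × Extends X (_<ᵗ u) X′ × v ∈ X′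
    add {v} {X} v<u run with em {P = v ∈ X}
    ... | yes v∈X = _ , _ , run , (id , inj₁) , v∈X
    ... | no  v∉X with X′ , M′ , run′ , (⊆′ , ⊇′) , past⊆X′ ← run-past (below v<u) run =
      v ∷ X′ , _ , step run′ ([ v∉X , <ᵗ-irrefl ] ∘ ⊇′) past⊆X′ ,
      (there ∘ ⊆′ , λ { (here refl) → inj₂ v<u
                      ; (there z∈) → Sum.map id (_⁺++ v<u) (⊇′ z∈) }) ,
      here refl

  <ᵗ-acc : ∀ u → Acc _<ᵗ_ u
  <ᵗ-acc u = finite-past⇒acc _⁺++_ <ᵗ-irrefl (finite-past u)

  -- First the past of `x` is run, then the missing part of the past of `y`. Neither `x` nor `y`
  -- belongs to these pasts, so both presets lie in the final cut, and they are disjoint because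
  -- places do not branch.
  unordered⇒concurrent : ∀ {x y} → x ≢ y → ¬ x <ᵗ y → ¬ y <ᵗ x →
                         ∃ λ M → Reachable em N M × ((N.•ᵗ (πᵗ x)) +ᴹ (N.•ᵗ (πᵗ y))) ⊆ᴹ M
  unordered⇒concurrent {x} {y} x≢y x≮y y≮x
    with X₁ , M₁ , run₁ , (⊆₁ , ⊇₁) , x-past ← run-past (<ᵗ-acc x) start
    with X₂ , M₂ , run₂ , (⊆₂ , ⊇₂) , y-past ← run-past (<ᵗ-acc y) run₁ =
    M₂ , run-reachable run₂ ,
    run-enabled-pair run₂ x≢y
      ([ [ (λ ()) , <ᵗ-irrefl ] ∘ ⊇₁ , x≮y ] ∘ ⊇₂) (⊆₂ ∘ x-past)
      ([ [ (λ ()) , y≮x ] ∘ ⊇₁ , <ᵗ-irrefl ] ∘ ⊇₂) y-past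

-- Ranks of consumers

module _ {em : ∀ {a} → ExcludedMiddle a} {ℓ} {N : Net ℓ} (s : Net.Place N) where
  private
    module N = Net N
    module P = Process

  Consumer : (P : Process em N) → Pred (P.Transition P) _
  Consumer P x = 0 < N.Fˢᵗ s (P.πᵗ P x)

  consumers-total : StructuralConflictNet em N → ∀ P {x y} → Consumer P x → Consumer P y →
                    x ≡ y ⊎ _<ᵗ_ P x y ⊎ _<ᵗ_ P y x
  consumers-total struct P {x} {y} cx cy
    with em {P = x ≡ y} | em {P = _<ᵗ_ P x y} | em {P = _<ᵗ_ P y x}
  ... | yes x≡y | _       | _       = inj₁ x≡y
  ... | no _    | yes x<y | _       = inj₂ (inj₁ x<y)
  ... | no _    | no _    | yes y<x = inj₂ (inj₂ y<x)
  ... | no x≢y  | no x≮y  | no y≮x  =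
    let M , reach , •xy⊆M = unordered⇒concurrent P x≢y x≮y y≮x
    in ⊥-elim (structural⇒disjoint em N struct reach •xy⊆M cx cy)

  -- Exactly n consumers precede x, and they form a chain.
  data Rank (P : Process em N) (x : P.Transition P) : ℕ → Set ℓ where
    first : (∀ {z} → Consumer P z → ¬ _<ᵗ_ P z x) → Rank P x 0
    next  : ∀ {z n} → Consumer P z → _<ᵗ_ P z x →
            (∀ {w} → Consumer P w → _<ᵗ_ P w x → w ≡ z ⊎ _<ᵗ_ P w z) →
            Rank P z n → Rank P x (suc n)

  module _ (struct : StructuralConflictNet em N) (P : Process em N) where

    -- Mutual induction on the rank. If `x` is below `y` at equal positive rank, their nearest
    -- preceding consumers have equal rank and coincide in some `z`; then `x` is at most `z`,
    -- although `z` is below `x`.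
    rank-injective : ∀ {x y n} → Consumer P x → Consumer P y → Rank P x n → Rank P y n → x ≡ y
    rank-≮ : ∀ {x y n} → Consumer P x → Rank P x n → Rank P y n → ¬ _<ᵗ_ P x y

    rank-injective cx cy rx ry with consumers-total struct P cx cy
    ... | inj₁ x≡y        = x≡y
    ... | inj₂ (inj₁ x<y) = contradiction x<y (rank-≮ cx rx ry)
    ... | inj₂ (inj₂ y<x) = contradiction y<x (rank-≮ cy ry rx)

    rank-≮ cx (first _) (first ≮y) x<y = ≮y cx x<y
    rank-≮ cx (next cz z<x _ rz) (next cw _ max rw) x<y
      with refl ← rank-injective cz cw rz rw | max cx x<y
    ... | inj₁ refl = <ᵗ-irrefl P z<x
    ... | inj₂ x<z  = <ᵗ-irrefl P (x<z ⁺++ z<x)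

  module _ {P Q : Process em N} (φ : P.Transition P → P.Transition Q)
           (π-φ : ∀ x → P.πᵗ P x ≡ P.πᵗ Q (φ x)) where

    consumer-φ⁺ : ∀ {x} → Consumer P x → Consumer Q (φ x)
    consumer-φ⁺ {x} = subst (λ t → 0 < N.Fˢᵗ s t) (π-φ x)

    consumer-φ⁻ : ∀ {x} → Consumer Q (φ x) → Consumer P x
    consumer-φ⁻ {x} = subst (λ t → 0 < N.Fˢᵗ s t) (sym (π-φ x))

    -- The two hypotheses make `φ` carry the chain of consumers below `x` onto the chain below
    -- `φ x`. They concern consumers only, because a swap may change the order of other transitions.
    rank-φ : (∀ {x y} → Consumer P x → Consumer P y → _<ᵗ_ P x y → _<ᵗ_ Q (φ x) (φ y)) →
             (∀ {z y} → Consumer P y → Consumer Q z → _<ᵗ_ Q z (φ y) → ∃ λ x → φ x ≡ z × _<ᵗ_ P x y) →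
             ∀ {x n} → Consumer P x → Rank P x n → Rank Q (φ x) n
    rank-φ mono pred {x} cx (first ≮x) = first λ cz z<φx → below cz (pred cx cz z<φx)
      where
      below : ∀ {z} → Consumer Q z → ¬ ∃ λ w → φ w ≡ z × _<ᵗ_ P w x
      below cz (w , refl , w<x) = ≮x (consumer-φ⁻ cz) w<x
    rank-φ mono pred {x} cx (next {z} cz z<x max rz) =
      next (consumer-φ⁺ cz) (mono cz cx z<x) (λ cw w<φx → below cw (pred cx cw w<φx)) (rank-φ mono pred cz rz)
      where
      below : ∀ {w} → Consumer Q w → (∃ λ v → φ v ≡ w × _<ᵗ_ P v x) → w ≡ φ z ⊎ _<ᵗ_ Q w (φ z)
      below cw (v , refl , v<x) = Sum.map (cong φ) (mono (consumer-φ⁻ cw) cz) (max (consumer-φ⁻ cw) v<x)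

  -- Ranks under prefix inclusion.

  module _ {P′ P : Process em N} (P′≤P : _≤ᴾ_ em P′ P) where
    open _≤ᴾ_ P′≤P
    private
      module P₁ = Process P′
      module P₂ = Process P

      ι : P₁.Node → P₂.Node
      ι = Sum.map ιˢ ιᵗ

      F-restricts : ∀ x y → P₁.F x y ≡ P₂.F (ι x) (ι y)
      F-restricts (inj₁ p) (inj₁ _) = refl
      F-restricts (inj₁ p) (inj₂ t) = Fˢᵗ-restricts p t
      F-restricts (inj₂ t) (inj₁ p) = Fᵗˢ-restricts t p
      F-restricts (inj₂ t) (inj₂ _) = refl

    prefix-F⁺ : ∀ {x y} → P₁.F⁺ x y → P₂.F⁺ (ι x) (ι y)
    prefix-F⁺ {x} {y} [ e ]⁺            = [ subst (0 <_) (F-restricts x y) e ]⁺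
    prefix-F⁺ {x} (_∷_ {y = y} e path) = subst (0 <_) (F-restricts x y) e ∷ prefix-F⁺ path

    -- t and its image have equally many preplaces with a given label.
    prefix-preset : ∀ {p t} → 0 < P₂.Fˢᵗ p (ιᵗ t) → ∃ λ p′ → ιˢ p′ ≡ p
    prefix-preset {p} {t} p∈•ιt with preset-list P′ t (P₂.πˢ p)
    ... | qs , ∣qs∣ , qs! , qs∈ with em {P = p ∈ List.map ιˢ qs}
    ... | yes p∈ with p′ , _ , eq ← ∈-map⁻ ιˢ p∈ = p′ , sym eq
    ... | no  p∉ = contradiction
      (unique-length-≤ (P₂.IsProcess.π-pre P₂.isProcess (ιᵗ t) (P₂.πˢ p))
        (All.tabulate (λ q∈ p≡q → p∉ (subst (_∈ List.map ιˢ qs) (sym p≡q) q∈)) ∷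
         Unique.map⁺ ιˢ-injective qs!)
        (in-preset refl p∈•ιt ∷ All.map⁺ (All.map image qs∈)))
      (<⇒≱ (s≤s (≤-reflexive (sym ∣map∣))))
      where
      ∣map∣ : length (List.map ιˢ qs) ≡ N.Fˢᵗ (P₂.πˢ p) (P₂.πᵗ (ιᵗ t))
      ∣map∣ = trans (length-map ιˢ qs) (trans ∣qs∣ (cong (N.Fˢᵗ _) (πᵗ-restricts t)))
      in-preset : ∀ {q} → P₂.πˢ q ≡ P₂.πˢ p → 0 < P₂.Fˢᵗ q (ιᵗ t) →
                  q ∈ᴹ preimage em P₂.πˢ (P₂.πˢ p) ∩ᴹ (P₂.•ᵗ (ιᵗ t))
      in-preset π≡ = ∈-∩⁺ (preimage em P₂.πˢ (P₂.πˢ p)) (P₂.•ᵗ (ιᵗ t))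
        (char-∈⁺ em (λ q → P₂.πˢ q ≡ P₂.πˢ p) π≡)
      image : ∀ {q} → P₁.πˢ q ≡ P₂.πˢ p × 0 < P₁.Fˢᵗ q t →
              ιˢ q ∈ᴹ preimage em P₂.πˢ (P₂.πˢ p) ∩ᴹ (P₂.•ᵗ (ιᵗ t))
      image {q} (π≡ , q∈•t) =
        in-preset (trans (sym (πˢ-restricts q)) π≡) (subst (0 <_) (Fˢᵗ-restricts q t) q∈•t)

    -- Without a producer in the prefix, `p` would be initially marked there, hence also in `P`,
    -- where places with a producer are unmarked. A producer in the prefix is mapped to the only one
    -- in `P`.
    prefix-producer : ∀ {t p} → 0 < P₂.Fᵗˢ t (ιˢ p) → ∃ λ t′ → ιᵗ t′ ≡ t
    prefix-producer {t} {p} t→ιp with em {P = ∃ λ t′ → 0 < P₁.Fᵗˢ t′ p}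
    ... | yes (t′ , t′→p) = t′ , AtMostOne⇒≡ (P₂.IsProcess.pre-≤1 P₂.isProcess (ιˢ p))
                                   (subst (0 <_) (Fᵗˢ-restricts t′ p) t′→p) t→ιp
    ... | no ∄ = contradiction (trans (sym marked) (trans (M₀-restricts p) unmarked)) λ ()
      where
      marked : P₁.M₀ p ≡ 1
      marked = P₁.IsProcess.initially-marked P₁.isProcess p (¬NonEmpty⇒Empty ∄)

      unmarked : P₂.M₀ (ιˢ p) ≡ 0
      unmarked = P₂.IsProcess.initially-empty P₂.isProcess (ιˢ p)
        λ empty → <-irrefl (sym (empty t)) t→ιp

    prefix-pred : ∀ {x} y → 0 < P₂.F x (ι y) → ∃ λ x′ → ι x′ ≡ x
    prefix-pred {inj₁ p} (inj₂ t) e with p′ , refl ← prefix-preset {p} {t} e = inj₁ p′ , refl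
    prefix-pred {inj₂ t} (inj₁ p) e with t′ , refl ← prefix-producer {t} {p} e = inj₂ t′ , refl
    prefix-pred {inj₁ _} (inj₁ _) ()
    prefix-pred {inj₂ _} (inj₂ _) ()

    -- Causal closure of prefixes: the path is pulled back edge by edge, starting from its end.
    prefix-down : ∀ {x z} y → z ≡ ι y → P₂.F⁺ x z → ∃ λ x′ → ι x′ ≡ x × P₁.F⁺ x′ y
    prefix-down {x} y refl [ e ]⁺ with x′ , refl ← prefix-pred {x} y e =
      x′ , refl , [ subst (0 <_) (sym (F-restricts x′ y)) e ]⁺
    prefix-down {x} y refl (e ∷ p)
      with w , refl , q ← prefix-down y refl p
      with x′ , refl ← prefix-pred {x} w e =
      x′ , refl , subst (0 <_) (sym (F-restricts x′ w)) e ∷ q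

    prefix-rank : ∀ {x n} → Consumer P′ x → Rank P′ x n → Rank P (ιᵗ x) n
    prefix-rank = rank-φ {P′} {P} ιᵗ πᵗ-restricts (λ _ _ → prefix-F⁺) pred
      where
      pred : ∀ {z y} → Consumer P′ y → Consumer P z → _<ᵗ_ P z (ιᵗ y) → ∃ λ x → ιᵗ x ≡ z × _<ᵗ_ P′ x y
      pred {y = y} _ _ z<ιy with prefix-down (inj₂ y) refl z<ιy
      ... | inj₂ x , refl , x<y = x , refl , x<y

  -- Ranks under swapping and isomorphism.

  module _ (P : Process em N) {p q : P.Place P}
           (p≮q : ¬ P.F⁺ P (inj₁ p) (inj₁ q)) (q≮p : ¬ P.F⁺ P (inj₁ q) (inj₁ p)) where
    private
      module P₁ = Process P
      module S  = LabelledPreNet (swap em P₁.labelledPreNet p q)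
      open P₁.IsProcess P₁.isProcess using () renaming (acyclic to P₁-acyclic)

    infix 4 _≤ⁿ_
    _≤ⁿ_ : P₁.Node → P₁.Node → Set _
    x ≤ⁿ y = x ≡ y ⊎ P₁.F⁺ x y

    swap-edge : ∀ x y → 0 < S.F x y →
                0 < P₁.F x y ⊎ (x ≡ inj₁ p × 0 < P₁.F (inj₁ q) y) ⊎ (x ≡ inj₁ q × 0 < P₁.F (inj₁ p) y)
    swap-edge (inj₂ t) (inj₁ s) e = inj₁ e
    swap-edge (inj₁ s) (inj₂ t) e with em {P = s ≡ p}
    ... | yes refl = inj₂ (inj₁ (refl , e))
    ... | no _ with em {P = s ≡ q}
    ... | yes refl = inj₂ (inj₂ (refl , e))
    ... | no _ = inj₁ e
    swap-edge (inj₁ _) (inj₁ _) ()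
    swap-edge (inj₂ _) (inj₂ _) ()

    infixr 5 _◁_
    _◁_ : ∀ {u v w} → 0 < P₁.F u v → v ≤ⁿ w → P₁.F⁺ u w
    e ◁ inj₁ refl = [ e ]⁺
    e ◁ inj₂ path = e ∷ path

    -- A second jump would put p and q in order.
    swap-F⁺ : ∀ {x y} → S.F⁺ x y →
              P₁.F⁺ x y ⊎ (x ≤ⁿ inj₁ p × P₁.F⁺ (inj₁ q) y) ⊎ (x ≤ⁿ inj₁ q × P₁.F⁺ (inj₁ p) y)
    swap-F⁺ {x} {y} [ e ]⁺ with swap-edge x y e
    ... | inj₁ e′                 = inj₁ [ e′ ]⁺
    ... | inj₂ (inj₁ (x≡p , q→y)) = inj₂ (inj₁ (inj₁ x≡p , [ q→y ]⁺))
    ... | inj₂ (inj₂ (x≡q , p→y)) = inj₂ (inj₂ (inj₁ x≡q , [ p→y ]⁺))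
    swap-F⁺ {x} {y} (_∷_ {y = z} e path) with swap-edge x z e | swap-F⁺ path
    ... | inj₁ x→z | inj₁ z<y = inj₁ (x→z ∷ z<y)
    ... | inj₁ x→z | inj₂ (inj₁ (z≤p , q<y)) = inj₂ (inj₁ (inj₂ (x→z ◁ z≤p) , q<y))
    ... | inj₁ x→z | inj₂ (inj₂ (z≤q , p<y)) = inj₂ (inj₂ (inj₂ (x→z ◁ z≤q) , p<y))
    ... | inj₂ (inj₁ (x≡p , q→z)) | inj₁ z<y = inj₂ (inj₁ (inj₁ x≡p , q→z ∷ z<y))
    ... | inj₂ (inj₁ (x≡p , q→z)) | inj₂ (inj₁ (z≤p , _)) = contradiction (q→z ◁ z≤p) q≮p
    ... | inj₂ (inj₁ (x≡p , q→z)) | inj₂ (inj₂ (z≤q , _)) = contradiction (q→z ◁ z≤q) (P₁-acyclic _)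
    ... | inj₂ (inj₂ (x≡q , p→z)) | inj₁ z<y = inj₂ (inj₂ (inj₁ x≡q , p→z ∷ z<y))
    ... | inj₂ (inj₂ (x≡q , p→z)) | inj₂ (inj₁ (z≤p , _)) = contradiction (p→z ◁ z≤p) (P₁-acyclic _)
    ... | inj₂ (inj₂ (x≡q , p→z)) | inj₂ (inj₂ (z≤q , _)) = contradiction (p→z ◁ z≤q) p≮q

    swap-order : ∀ {a b} → P₁.F⁺ (inj₂ a) (inj₂ b) → ¬ S.F⁺ (inj₂ b) (inj₂ a)
    swap-order a<b b<a with swap-F⁺ b<a
    ... | inj₁ b<a = P₁-acyclic _ (a<b ⁺++ b<a)
    ... | inj₂ (inj₁ (inj₂ b<p , q<a)) = q≮p (q<a ⁺++ a<b ⁺++ b<p)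
    ... | inj₂ (inj₂ (inj₂ b<q , p<a)) = p≮q (p<a ⁺++ a<b ⁺++ b<q)

  module _ {P Q : LabelledPreNet em {N = N}} (P≅Q : _≅_ em P Q) where
    open _≅_ P≅Q
    private
      module P₁ = LabelledPreNet P
      module P₂ = LabelledPreNet Q

      φ⁻¹ : P₂.Node → P₁.Node
      φ⁻¹ = Sum.map φˢ.from φᵗ.from

      F-φ⁻¹ : ∀ x y → P₂.F x y ≡ P₁.F (φ⁻¹ x) (φ⁻¹ y)
      F-φ⁻¹ (inj₁ p) (inj₁ _) = refl
      F-φ⁻¹ (inj₁ p) (inj₂ t) =
        trans (cong₂ P₂.Fˢᵗ (sym (φˢ.strictlyInverseˡ p)) (sym (φᵗ.strictlyInverseˡ t))) (preserves-Fˢᵗ _ _)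
      F-φ⁻¹ (inj₂ t) (inj₁ p) =
        trans (cong₂ P₂.Fᵗˢ (sym (φᵗ.strictlyInverseˡ t)) (sym (φˢ.strictlyInverseˡ p))) (preserves-Fᵗˢ _ _)
      F-φ⁻¹ (inj₂ t) (inj₂ _) = refl

    iso-F⁺ : ∀ {x y} → P₂.F⁺ x y → P₁.F⁺ (φ⁻¹ x) (φ⁻¹ y)
    iso-F⁺ {x} {y} [ e ]⁺            = [ subst (0 <_) (F-φ⁻¹ x y) e ]⁺
    iso-F⁺ {x} (_∷_ {y = y} e path) = subst (0 <_) (F-φ⁻¹ x y) e ∷ iso-F⁺ path

    iso-<ᵗ : ∀ {a b} → P₂.F⁺ (inj₂ (φᵗ.to a)) (inj₂ (φᵗ.to b)) → P₁.F⁺ (inj₂ a) (inj₂ b)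
    iso-<ᵗ a<b = subst₂ (λ a b → P₁.F⁺ (inj₂ a) (inj₂ b))
      (φᵗ.strictlyInverseʳ _) (φᵗ.strictlyInverseʳ _) (iso-F⁺ a<b)

  -- By `swap-order` the order of two consumers is never reversed. Totality in `Q` turns this into
  -- preservation, and totality in `P` then gives reflection.
  swap-rank : StructuralConflictNet em N → ∀ {P Q} → _≡₁_ em P Q →
              ∃ λ (φ : P.Transition P → P.Transition Q) → (∀ x → P.πᵗ P x ≡ P.πᵗ Q (φ x)) ×
              (∀ {x n} → Consumer P x → Rank P x n → Rank Q (φ x) n)
  swap-rank struct {P} {Q} (p , q , p≮q , q≮p , _ , iso) =
    φᵗ.to , preserves-πᵗ , rank-φ {P} {Q} φᵗ.to preserves-πᵗ mono pred
    where
    open _≅_ iso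
    mono : ∀ {x y} → Consumer P x → Consumer P y → _<ᵗ_ P x y → _<ᵗ_ Q (φᵗ.to x) (φᵗ.to y)
    mono {x} {y} cx cy x<y
      with consumers-total struct Q (consumer-φ⁺ {P} {Q} φᵗ.to preserves-πᵗ cx)
                                    (consumer-φ⁺ {P} {Q} φᵗ.to preserves-πᵗ cy)
    ... | inj₂ (inj₁ φx<φy) = φx<φy
    ... | inj₂ (inj₂ φy<φx) = contradiction (iso-<ᵗ iso φy<φx) (swap-order P p≮q q≮p x<y)
    ... | inj₁ φx≡φy =
      contradiction (subst (_<ᵗ_ P x) (sym (Injection.injective (↔⇒↣ φᵗ) φx≡φy)) x<y) (<ᵗ-irrefl P)

    order-reflect : ∀ {x y} → Consumer P x → Consumer P y → _<ᵗ_ Q (φᵗ.to x) (φᵗ.to y) → _<ᵗ_ P x y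
    order-reflect cx cy φx<φy with consumers-total struct P cx cy
    ... | inj₁ refl       = contradiction φx<φy (<ᵗ-irrefl Q)
    ... | inj₂ (inj₁ x<y) = x<y
    ... | inj₂ (inj₂ y<x) = contradiction (φx<φy ⁺++ mono cy cx y<x) (<ᵗ-irrefl Q)

    pred : ∀ {z y} → Consumer P y → Consumer Q z → _<ᵗ_ Q z (φᵗ.to y) → ∃ λ x → φᵗ.to x ≡ z × _<ᵗ_ P x y
    pred {z} cy cz z<φy = φᵗ.from z , φᵗ.strictlyInverseˡ z ,
      order-reflect
        (consumer-φ⁻ {P} {Q} φᵗ.to preserves-πᵗ (subst (Consumer Q) (sym (φᵗ.strictlyInverseˡ z)) cz)) cy
        (subst (λ w → _<ᵗ_ Q w _) (sym (φᵗ.strictlyInverseˡ z)) z<φy)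

-- Processes of firing sequences

-- The offset `a` accounts for the tokens that are present initially.
partialSum : ℕ → (ℕ → ℕ) → ℕ → ℕ
partialSum a f zero    = a
partialSum a f (suc i) = partialSum a f i + f i

partialSum-mono : ∀ a f {i j} → i ≤ j → partialSum a f i ≤ partialSum a f j
partialSum-mono a f {i} {j} i≤j with m≤n⇒m<n∨m≡n i≤j
... | inj₂ refl = ≤-refl
partialSum-mono a f {i} {suc j} i≤j | inj₁ i<j =
  ≤-trans (partialSum-mono a f (s≤s⁻¹ i<j)) (m≤m+n _ (f j))

partialSum-cong : ∀ {a f g i} → (∀ {j} → j < i → f j ≡ g j) → partialSum a f i ≡ partialSum a g i
partialSum-cong {i = zero}  f≗g = refl
partialSum-cong {i = suc i} f≗g = cong₂ _+_ (partialSum-cong (f≗g ∘ m<n⇒m<1+n)) (f≗g ≤-refl)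

-- Consecutive partial sums cut the numbers into half-open intervals. This recovers, from the number
-- of a token, the transition that produced it.
partialSum-locate : ∀ a f {m k} → k < partialSum a f m →
                    k < a ⊎ ∃ λ i → i < m × partialSum a f i ≤ k × k < partialSum a f (suc i)
partialSum-locate a f {zero} k<a = inj₁ k<a
partialSum-locate a f {suc m} {k} k< with k <? partialSum a f m
... | no  ≮k = inj₂ (m , ≤-refl , ≮⇒≥ ≮k , k<)
... | yes <k with partialSum-locate a f {m} <k
... | inj₁ k<a = inj₁ k<a
... | inj₂ (i , i<m , bounds) = inj₂ (i , m<n⇒m<1+n i<m , bounds)

partialSum-unique : ∀ a f {i j k} → partialSum a f i ≤ k → k < partialSum a f (suc i) →
                    partialSum a f j ≤ k → k < partialSum a f (suc j) → i ≡ j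
partialSum-unique a f {i} {j} i≤k k<i j≤k k<j with <-cmp i j
... | tri≈ _ i≡j _ = i≡j
... | tri< i<j _ _ = contradiction (<-≤-trans k<i (≤-trans (partialSum-mono a f i<j) j≤k)) (<-irrefl refl)
... | tri> _ _ j<i = contradiction (<-≤-trans k<j (≤-trans (partialSum-mono a f j<i) i≤k)) (<-irrefl refl)

-- A firing sequence is a total function of which the first `m` values matter, so appending a
-- transition means overwriting the value at `m`.
update : ∀ {a} {X : Set a} → (ℕ → X) → ℕ → X → ℕ → X
update τ m t i with i ≟ m
... | yes _ = t
... | no  _ = τ i

update-≡ : ∀ {a} {X : Set a} (τ : ℕ → X) m t → update τ m t m ≡ t
update-≡ τ m t with m ≟ m
... | yes _  = refl
... | no m≢m = contradiction refl m≢m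

update-< : ∀ {a} {X : Set a} (τ : ℕ → X) {m} t {i} → i < m → update τ m t i ≡ τ i
update-< τ {m} t {i} i<m with i ≟ m
... | yes i≡m = contradiction i≡m (<⇒≢ i<m)
... | no _    = refl

module _ {ℓ} (N : Net ℓ) (τ : ℕ → Net.Transition N) where
  open Net N

  consumed produced : ℕ → Place → ℕ
  consumed i s = partialSum 0 (λ j → Fˢᵗ s (τ j)) i
  produced i s = partialSum (M₀ s) (λ j → Fᵗˢ (τ j) s) i

  -- Cumulative form of enabledness: whatever transition `i` and its predecessors take was there
  -- before transition `i`.
  Fireable : ℕ → Set ℓ
  Fireable m = ∀ {i} → i < m → ∀ s → consumed (suc i) s ≤ produced i s

  -- M is reached by firing the first m transitions of τ; stated additively,
  -- so that no truncated subtraction occurs.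
  History : ℕ → Marking → Set ℓ
  History m M = Fireable m × (∀ s → M s + consumed m s ≡ produced m s)

module _ (em : ∀ {a} → ExcludedMiddle a) {ℓ} (N : Net ℓ) where
  open Net N

  history-fire : ∀ {τ m M t} → History N τ m M → (•ᵗ t) ⊆ᴹ M →
                 History N (update τ m t) (suc m) (fire em N M t)
  history-fire {τ} {m} {M} {t} (fireable , M≡) •t⊆M = fireable′ , M′≡
    where
    τ′ = update τ m t

    consumed≡ : ∀ {i} → i ≤ m → ∀ s → consumed N τ′ i s ≡ consumed N τ i s
    consumed≡ i≤m s = partialSum-cong λ j<i → cong (Fˢᵗ s) (update-< τ t (<-≤-trans j<i i≤m))

    produced≡ : ∀ {i} → i ≤ m → ∀ s → produced N τ′ i s ≡ produced N τ i s
    produced≡ i≤m s = partialSum-cong λ j<i → cong (λ u → Fᵗˢ u s) (update-< τ t (<-≤-trans j<i i≤m))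

    consumed-suc : ∀ s → consumed N τ′ (suc m) s ≡ consumed N τ m s + Fˢᵗ s t
    consumed-suc s = cong₂ _+_ (consumed≡ ≤-refl s) (cong (Fˢᵗ s) (update-≡ τ m t))

    fireable′ : Fireable N τ′ (suc m)
    fireable′ {i} i<1+m s with m≤n⇒m<n∨m≡n (s≤s⁻¹ i<1+m)
    ... | inj₁ i<m = subst₂ _≤_ (sym (consumed≡ i<m s)) (sym (produced≡ (<⇒≤ i<m) s)) (fireable i<m s)
    ... | inj₂ refl = begin
      consumed N τ′ (suc m) s        ≡⟨ consumed-suc s ⟩
      consumed N τ m s + Fˢᵗ s t     ≤⟨ +-monoʳ-≤ (consumed N τ m s) (•t⊆M s) ⟩
      consumed N τ m s + M s         ≡⟨ +-comm (consumed N τ m s) (M s) ⟩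
      M s + consumed N τ m s         ≡⟨ M≡ s ⟩
      produced N τ m s               ≡⟨ produced≡ ≤-refl s ⟨
      produced N τ′ m s              ∎
      where open ≤-Reasoning

    M′≡ : ∀ s → fire em N M t s + consumed N τ′ (suc m) s ≡ produced N τ′ (suc m) s
    M′≡ s = begin
      M s ∸ Fˢᵗ s t + Fᵗˢ t s + consumed N τ′ (suc m) s
        ≡⟨ cong (M s ∸ Fˢᵗ s t + Fᵗˢ t s +_) (consumed-suc s) ⟩
      M s ∸ Fˢᵗ s t + Fᵗˢ t s + (consumed N τ m s + Fˢᵗ s t)
        ≡⟨ solve 4 (λ x g c f → x :+ g :+ (c :+ f) := x :+ f :+ c :+ g) refl
             (M s ∸ Fˢᵗ s t) (Fᵗˢ t s) (consumed N τ m s) (Fˢᵗ s t) ⟩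
      M s ∸ Fˢᵗ s t + Fˢᵗ s t + consumed N τ m s + Fᵗˢ t s
        ≡⟨ cong (λ x → x + consumed N τ m s + Fᵗˢ t s) (m∸n+n≡m (•t⊆M s)) ⟩
      M s + consumed N τ m s + Fᵗˢ t s
        ≡⟨ cong₂ _+_ (trans (M≡ s) (sym (produced≡ ≤-refl s)))
             (cong (λ u → Fᵗˢ u s) (sym (update-≡ τ m t))) ⟩
      produced N τ′ (suc m) s ∎
      where
      open ≡-Reasoning
      open +-*-Solver

  history-≗ : ∀ {τ m M M′} → M′ ≗ M → History N τ m M → History N τ m M′
  history-≗ M′≗M (fireable , M≡) = fireable , λ s → trans (cong (_+ _) (M′≗M s)) (M≡ s)

  fires⇒history : ∀ {τ m M σ M′} → History N τ m M → Fires em N M σ M′ →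
                  ∃₂ λ τ′ m′ → History N τ′ m′ M′
  fires⇒history h ([] M′≗M) = _ , _ , history-≗ M′≗M h
  fires⇒history h (fired ∷ fires) =
    let •t⊆M , M₁≗ = singleStep⁻ em N fired
    in fires⇒history (history-≗ M₁≗ (history-fire h •t⊆M)) fires

  reachable⇒history : ∀ {M} → Transition → Reachable em N M → ∃₂ λ τ m → History N τ m M
  reachable⇒history t (_ , fires) =
    -- Here `t` is only a default value for the positions of `τ` beyond the sequence.
    fires⇒history {τ = λ _ → t} {m = 0} ((λ ()) , λ s → +-identityʳ (M₀ s)) fires

-- The tokens that visit a place s in the course of the firing sequence τ are
-- numbered in the order of their arrival, and consumed in that order.
module FIFO (em : ∀ {a} → ExcludedMiddle a) {ℓ} (N : Net ℓ) (τ : ℕ → Net.Transition N)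
            (m : ℕ) (fireable : Fireable N τ m) where
  private
    module N = Net N
    module NN = N.IsNet N.isNet

    Token : Set ℓ
    Token = Σ N.Place λ s → Fin (produced N τ m s)

    Interval : (lo hi : N.Place → ℕ) → Pred Token _
    Interval lo hi (s , k) = lo s ≤ toℕ k × toℕ k < hi s

    produced-mono : ∀ {i j} → i ≤ j → ∀ s → produced N τ i s ≤ produced N τ j s
    produced-mono i≤j s = partialSum-mono (N.M₀ s) (λ j → N.Fᵗˢ (τ j) s) i≤j

    Consumes Produces : Fin m → Pred Token _
    Consumes i = Interval (consumed N τ (toℕ i)) (consumed N τ (suc (toℕ i)))
    Produces i = Interval (produced N τ (toℕ i)) (produced N τ (suc (toℕ i)))

    Initial : Pred Token _
    Initial = Interval (λ _ → 0) N.M₀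

    consumed≤produced : ∀ (i : Fin m) s → consumed N τ (suc (toℕ i)) s ≤ produced N τ m s
    consumed≤produced i s = ≤-trans (fireable (toℕ<n i) s) (produced-mono (<⇒≤ (toℕ<n i)) s)

    -- With the length given by an equation rather than a difference, `refl` proves it for the
    -- initial, the consumed and the produced tokens alike.
    ∣Interval∣ : ∀ {lo hi} s {n} → lo s + n ≡ hi s → hi s ≤ produced N τ m s →
                 ∣ preimage em proj₁ s ∩ᴹ char em (Interval lo hi) ∣≡ n
    ∣Interval∣ {lo} {hi} s {n} lo+n≡hi hi≤ = ∣∣≡-enumeration f
      (λ x → ≤-trans (m⊓n≤m _ _) (char-≤1 em On x))
      (λ {i} {j} eq → toℕ-injective (+-cancelˡ-≡ (lo s) _ _ (trans (sym (toℕ-fromℕ< (bound i)))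
        (trans (cong-toℕ eq) (toℕ-fromℕ< (bound j))))))
      (λ i → ∈-∩⁺ (preimage em proj₁ s) (char em (Interval lo hi))
        (char-∈⁺ em On {f i} refl)
        (char-∈⁺ em (Interval lo hi)
          ( ≤-trans (m≤m+n (lo s) (toℕ i)) (≤-reflexive (sym (toℕ-fromℕ< (bound i))))
          , subst (_< hi s) (sym (toℕ-fromℕ< (bound i))) (below i))))
      λ x x∈ → let x∈s , x∈I = ∈-∩⁻ (preimage em proj₁ s) (char em (Interval lo hi)) x∈
               in onto x (char-∈⁻ em On {x} x∈s) (char-∈⁻ em (Interval lo hi) x∈I)
      where
      On : Pred Token ℓ
      On x = proj₁ x ≡ s
      below : ∀ (i : Fin n) → lo s + toℕ i < hi s
      below i = subst (lo s + toℕ i <_) lo+n≡hi (+-monoʳ-< (lo s) (toℕ<n i))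
      bound : ∀ (i : Fin n) → lo s + toℕ i < produced N τ m s
      bound i = <-≤-trans (below i) hi≤
      f : Fin n → Token
      f i = s , fromℕ< (bound i)
      cong-toℕ : ∀ {k l : Fin (produced N τ m s)} → _≡_ {A = Token} (s , k) (s , l) → toℕ k ≡ toℕ l
      cong-toℕ refl = refl
      onto : ∀ x → proj₁ x ≡ s → Interval lo hi x → ∃ λ i → f i ≡ x
      onto (_ , k) refl (lo≤k , k<hi) = fromℕ< k∸lo<n , cong (s ,_) (toℕ-injective
        (trans (toℕ-fromℕ< (bound _)) (trans (cong (lo s +_) (toℕ-fromℕ< k∸lo<n)) (m+[n∸m]≡n lo≤k))))
        where
        k∸lo<n : toℕ k ∸ lo s < n
        k∸lo<n = +-cancelˡ-< (lo s) _ _ (subst₂ _<_ (sym (m+[n∸m]≡n lo≤k)) (sym lo+n≡hi) k<hi)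

    tokens-on : ∀ {p} {Q : Pred N.Place p} → FiniteSet Q → FiniteSet {X = Token} (Q ∘ proj₁)
    tokens-on (ss , Q⊆ss) =
      concatMap (λ s → List.map (s ,_) (allFin _)) ss ,
      λ {(s , k)} Qs → ∈-concatMap⁺ (λ s → List.map (s ,_) (allFin _))
        (lose (Q⊆ss Qs) (∈-map⁺ (s ,_) (∈-allFin k)))

    nonempty-interval : ∀ {a b k} → a ≤ k → k < a + b → 0 < b
    nonempty-interval {a} {b} a≤k k<a+b =
      +-cancelˡ-< a 0 b (subst (_< a + b) (sym (+-identityʳ a)) (≤-<-trans a≤k k<a+b))

    preNet : PreNet ℓ
    preNet = record
      { Place      = Token
      ; Transition = Lift ℓ (Fin m)
      ; Fˢᵗ        = λ p (lift i) → char em (Consumes i) p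
      ; Fᵗˢ        = λ (lift i) p → char em (Produces i) p
      ; M₀         = char em Initial
      }

    labelled : LabelledPreNet em {N = N}
    labelled = record { preNet = preNet ; πˢ = proj₁ ; πᵗ = τ ∘ toℕ ∘ lower }

    open PreNet preNet using (F; F⁺)

    -- Invariant of the paths that leave transition `i`: they meet only later transitions and tokens
    -- that arrive with `i` or afterwards.
    After : Fin m → PreNet.Node preNet → Set
    After i (inj₁ (s , k)) = produced N τ (toℕ i) s ≤ toℕ k
    After i (inj₂ (lift j)) = toℕ i < toℕ j

    -- By `Fireable`, a token consumed by `j` was produced before `j`. For `j` at most `i` its
    -- number would therefore be less than `produced N τ (toℕ i) s`.
    after-step : ∀ {i x y} → After i x → 0 < F x y → After i y
    after-step {i} {inj₁ p@(s , k)} {inj₂ (lift j)} i≤k e =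
      ≰⇒> λ j≤i → <-irrefl refl (<-≤-trans (proj₂ (char-∈⁻ em (Consumes j) {p} e))
        (≤-trans (fireable (toℕ<n j) s) (≤-trans (produced-mono j≤i s) i≤k)))
    after-step {i} {inj₂ (lift j)} {inj₁ p@(s , k)} i<j e =
      ≤-trans (produced-mono (<⇒≤ i<j) s) (proj₁ (char-∈⁻ em (Produces j) {p} e))
    after-step {x = inj₁ _} {inj₁ _} _ ()
    after-step {x = inj₂ _} {inj₂ _} _ ()

    after-F⁺ : ∀ {i x y} → After i x → F⁺ x y → After i y
    after-F⁺ {i} {x} {y} after [ e ]⁺ = after-step {i} {x} {y} after e
    after-F⁺ {i} {x} after (_∷_ {y = y} e path) = after-F⁺ (after-step {i} {x} {y} after e) path

    F⁺⇒after : ∀ {i y} → F⁺ (inj₂ (lift i)) y → After i y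
    F⁺⇒after {i} {inj₁ p} [ e ]⁺ = proj₁ (char-∈⁻ em (Produces i) {p} e)
    F⁺⇒after {i} (_∷_ {y = inj₁ p} e path) =
      after-F⁺ {i} {inj₁ p} (proj₁ (char-∈⁻ em (Produces i) {p} e)) path

    acyclic : ∀ x → ¬ F⁺ x x
    acyclic (inj₂ (lift i)) i<i = <-irrefl refl (F⁺⇒after {i} i<i)
    -- A cycle through a place is rotated into one through the transition that follows it.
    acyclic (inj₁ p) (_∷_ {y = inj₂ (lift i)} e path) =
      <-irrefl refl (F⁺⇒after {i} {inj₂ (lift i)} (_⁺∷ʳ_ {y = inj₁ p} path e))

  process : Process em N
  process = record
    { labelledPreNet = labelled
    ; isProcess = record
      { isNet = record
        { pre-finite   = λ (lift i) →
            let ps , ∈ps = tokens-on (NN.pre-finite (τ (toℕ i)))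
            in ps , λ {p} e → let lo , hi = char-∈⁻ em (Consumes i) {p} e in ∈ps (nonempty-interval lo hi)
        ; pre-nonempty = λ (lift i) →
            let s , s∈ = NN.pre-nonempty (τ (toℕ i))
                c<     = m<m+n (consumed N τ (toℕ i) s) s∈
                k<     = <-≤-trans c< (consumed≤produced i s)
            in (s , fromℕ< k<) , char-∈⁺ em (Consumes i)
                 ( ≤-reflexive (sym (toℕ-fromℕ< k<))
                 , subst (_< consumed N τ (suc (toℕ i)) s) (sym (toℕ-fromℕ< k<)) c<)
        ; post-finite  = λ (lift i) →
            let ps , ∈ps = tokens-on (NN.post-finite (τ (toℕ i)))
            in ps , λ {p} e → let lo , hi = char-∈⁻ em (Produces i) {p} e in ∈ps (nonempty-interval lo hi)
        }
      ; pre-≤1 = λ p@(s , k) → AtMostOne⁺ em (λ (lift i) → char-≤1 em (Produces i) p)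
          λ {(lift i)} {(lift j)} ei ej →
            let loi , hii = char-∈⁻ em (Produces i) {p} ei
                loj , hij = char-∈⁻ em (Produces j) {p} ej
            in cong lift (toℕ-injective (partialSum-unique (N.M₀ s) (λ j → N.Fᵗˢ (τ j) s) loi hii loj hij))
      ; post-≤1 = λ p@(s , k) → AtMostOne⁺ em (λ (lift i) → char-≤1 em (Consumes i) p)
          λ {(lift i)} {(lift j)} ei ej →
            let loi , hii = char-∈⁻ em (Consumes i) {p} ei
                loj , hij = char-∈⁻ em (Consumes j) {p} ej
            in cong lift (toℕ-injective (partialSum-unique 0 (λ j → N.Fˢᵗ s (τ j)) loi hii loj hij))
      ; initially-marked = λ p empty → char-yes em Initial (z≤n , unproduced⇒initial p empty)
      ; initially-empty  = λ p@(s , k) ¬empty → char-no em Initial λ (_ , k<M₀) → ¬empty λ (lift i) →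
          char-no em (Produces i) λ (lo , _) → <-irrefl refl
            (<-≤-trans k<M₀ (≤-trans (produced-mono {0} {toℕ i} z≤n s) lo))
      ; acyclic     = acyclic
      ; finite-past = λ _ → List.map lift (allFin m) , λ {(lift i)} _ → ∈-map⁺ lift (∈-allFin i)
      ; π-M₀   = λ s → ∣Interval∣ s refl (produced-mono {0} {m} z≤n s)
      ; π-pre  = λ (lift i) s → ∣Interval∣ s refl (consumed≤produced i s)
      ; π-post = λ (lift i) s → ∣Interval∣ s refl (produced-mono (toℕ<n i) s)
      }
    }
    where
    unproduced⇒initial : ∀ p → (∀ t → PreNet.Fᵗˢ preNet t p ≡ 0) → toℕ (proj₂ p) < N.M₀ (proj₁ p)
    unproduced⇒initial (s , k) empty with partialSum-locate (N.M₀ s) (λ j → N.Fᵗˢ (τ j) s) (toℕ<n k)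
    ... | inj₁ k<M₀ = k<M₀
    ... | inj₂ (i , i<m , lo , hi) = contradiction (empty (lift (fromℕ< i<m)))
      (≢-sym (<⇒≢ (char-∈⁺ em (Produces (fromℕ< i<m))
        ( subst (λ i → produced N τ i s ≤ toℕ k) (sym (toℕ-fromℕ< i<m)) lo
        , subst (λ i → toℕ k < produced N τ (suc i) s) (sym (toℕ-fromℕ< i<m)) hi))))

  process-finite : FiniteProcess em process
  process-finite = List.map lift (allFin m) , λ (lift i) → ∈-map⁺ lift (∈-allFin i)

  <ᵗ⇒< : ∀ {i j} → _<ᵗ_ process (lift i) (lift j) → toℕ i < toℕ j
  <ᵗ⇒< {i} = F⁺⇒after {i}

  module _ (struct : StructuralConflictNet em N) (s : N.Place) where

    -- No causal path from `i` to `j` is constructed: the consumers are comparable, and the opposite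
    -- order would contradict `<ᵗ⇒<`.
    <⇒<ᵗ : ∀ {i j} → Consumer s process (lift i) → Consumer s process (lift j) →
           toℕ i < toℕ j → _<ᵗ_ process (lift i) (lift j)
    <⇒<ᵗ ci cj i<j with consumers-total s struct process ci cj
    ... | inj₁ refl       = contradiction i<j (<-irrefl refl)
    ... | inj₂ (inj₁ i<ᵗj) = i<ᵗj
    ... | inj₂ (inj₂ j<ᵗi) = contradiction (<-trans i<j (<ᵗ⇒< j<ᵗi)) (<-irrefl refl)

    -- The index `k` descends from the position of `i` over positions without consumers. The first
    -- consumer met is the nearest predecessor, from which the count continues. Taking `1 ⊓` counts
    -- a consumer once, whatever its arc weight.
    process-rank : ∀ k {i} → Consumer s process (lift i) → k ≤ toℕ i →
                   (∀ {j} → Consumer s process (lift j) → k ≤ toℕ j → ¬ toℕ j < toℕ i) →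
                   Rank s process (lift i) (partialSum 0 (λ j → 1 ⊓ N.Fˢᵗ s (τ j)) k)
    process-rank zero ci _ none = first λ {(lift j)} cj j<i → none cj z≤n (<ᵗ⇒< j<i)
    process-rank (suc k) {i} ci k<i none with N.Fˢᵗ s (τ k) in eq
    ... | zero = subst (Rank s process (lift i)) (sym (+-identityʳ _))
      (process-rank k ci (<⇒≤ k<i) λ cj k≤j →
        [ none cj
        , (λ k≡j _ → n≮0 (subst (0 <_) (trans (cong (N.Fˢᵗ s ∘ τ) (sym k≡j)) eq) cj))
        ] (m≤n⇒m<n∨m≡n k≤j))
    ... | suc f = subst (Rank s process (lift i)) (sym (+-comm _ 1))
      (next {z = lift z} cz (<⇒<ᵗ cz ci (subst (_< toℕ i) (sym z≡k) k<i))
        (λ {(lift w)} cw w<i → below cw (≮⇒≥ λ k<w → none cw k<w (<ᵗ⇒< w<i)))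
        (process-rank k cz (≤-reflexive (sym z≡k)) λ _ k≤j j<z → <-irrefl (sym z≡k) (≤-<-trans k≤j j<z)))
      where
      k<m : k < m
      k<m = <-trans k<i (toℕ<n i)
      z : Fin m
      z = fromℕ< k<m
      z≡k : toℕ z ≡ k
      z≡k = toℕ-fromℕ< k<m
      cz : Consumer s process (lift z)
      cz = subst (0 <_) (sym (trans (cong (N.Fˢᵗ s ∘ τ) z≡k) eq)) (s≤s z≤n)
      below : ∀ {w} → Consumer s process (lift w) → toℕ w ≤ k →
              lift w ≡ lift z ⊎ _<ᵗ_ process (lift w) (lift z)
      below cw w≤k with m≤n⇒m<n∨m≡n w≤k
      ... | inj₁ w<k = inj₂ (<⇒<ᵗ cw cz (subst (toℕ _ <_) (sym z≡k) w<k))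
      ... | inj₂ w≡k = inj₁ (cong lift (toℕ-injective (trans w≡k (sym z≡k))))

-- Ranks inherited by a largest process.

≤ᴾ-refl : ∀ {em : ∀ {a} → ExcludedMiddle a} {ℓ} {N : Net ℓ} {P : Process em N} → _≤ᴾ_ em P P
≤ᴾ-refl = record
  { ιˢ = id ; ιᵗ = id ; ιˢ-injective = id ; ιᵗ-injective = id
  ; M₀-restricts = λ _ → refl ; M₀-covered = λ s _ → s , refl
  ; Fˢᵗ-restricts = λ _ _ → refl ; Fᵗˢ-restricts = λ _ _ → refl
  ; πˢ-restricts = λ _ → refl ; πᵗ-restricts = λ _ → refl
  }

module _ {em : ∀ {a} → ExcludedMiddle a} {ℓ} {N : Net ℓ} (struct : StructuralConflictNet em N)
         (s : Net.Place N) where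
  private
    module N = Net N
    module P = Process

  HasRanked : Process em N → N.Transition → ℕ → Set ℓ
  HasRanked P t n = ∃ λ x → P.πᵗ P x ≡ t × Rank s P x n

  ≡₁*-ranked : ∀ {P Q t n} → 0 < N.Fˢᵗ s t → _≡₁*_ em P Q → HasRanked P t n → HasRanked Q t n
  ≡₁*-ranked ct ε x = x
  ≡₁*-ranked ct (_◅_ {j = P′} P≡₁P′ P′≡₁*Q) (x , refl , rank) =
    let φ , π-φ , rank-φ = swap-rank s struct P≡₁P′
    in ≡₁*-ranked ct P′≡₁*Q (φ x , sym (π-φ x) , rank-φ ct rank)

  ≤ᴾ-ranked : ∀ {P Q t n} → 0 < N.Fˢᵗ s t → _≤ᴾ_ em P Q → HasRanked P t n → HasRanked Q t n
  ≤ᴾ-ranked ct P≤Q (x , refl , rank) =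
    _≤ᴾ_.ιᵗ P≤Q x , sym (_≤ᴾ_.πᵗ-restricts P≤Q x) , prefix-rank s P≤Q ct rank

  -- A finite process is a finite prefix of itself, so it is linked to `Q` by an extension, swaps
  -- and a further extension, all of which keep label and rank.
  ⊑₁∞-ranked : ∀ {P Q t n} → FiniteProcess em P → 0 < N.Fˢᵗ s t → _⊑₁∞_ em P Q →
               HasRanked P t n → HasRanked Q t n
  ⊑₁∞-ranked {P} finite ct P⊑Q ranked =
    let _ , _ , _ , _ , P≤P′ , P′≡₁*Q′ , Q′≤Q = P⊑Q P finite ≤ᴾ-refl
    in ≤ᴾ-ranked ct Q′≤Q (≡₁*-ranked ct P′≡₁*Q′ (≤ᴾ-ranked ct P≤P′ ranked))

  -- The process of the sequence continued by `t` ends in a transition whose rank counts only the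
  -- consumers before position `m`. The rank is thus the same for every `t`.
  largest-ranked : ∀ {P} → (∀ Q → _⊑₁∞_ em Q P) → ∀ {τ m M} → History N τ m M →
                   ∀ {t} → (N.•ᵗ t) ⊆ᴹ M → 0 < N.Fˢᵗ s t →
                   HasRanked P t (partialSum 0 (λ j → 1 ⊓ N.Fˢᵗ s (τ j)) m)
  largest-ranked {P} largest {τ} {m} history {t} •t⊆M ct =
    ⊑₁∞-ranked process-finite ct (largest process) (lift (fromℕ m) , π-last , rank-last)
    where
    open FIFO em N (update τ m t) (suc m) (proj₁ (history-fire em N history •t⊆M))

    last≡m : toℕ (fromℕ m) ≡ m
    last≡m = toℕ-fromℕ m

    π-last : P.πᵗ process (lift (fromℕ m)) ≡ t
    π-last = trans (cong (update τ m t) last≡m) (update-≡ τ m t)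

    rank-last : Rank s process (lift (fromℕ m)) (partialSum 0 (λ j → 1 ⊓ N.Fˢᵗ s (τ j)) m)
    rank-last = subst (Rank s process _)
      (partialSum-cong {i = m} λ j<m → cong (λ u → 1 ⊓ N.Fˢᵗ s u) (update-< τ t j<m))
      (process-rank struct s m (subst (λ u → 0 < N.Fˢᵗ s u) (sym π-last) ct) (≤-reflexive (sym last≡m))
        λ _ m≤j j<last → <-irrefl (sym last≡m) (≤-<-trans m≤j j<last))

theorem1 : ∀ {ℓ} (em : ∀ {a} → ExcludedMiddle a) (N : Net ℓ) →
    StructuralConflictNet em N →
    HasLargestBDProcess em N →
    ConflictFree em N
theorem1 em N struct (P , largest) G finite nonempty M reach =
  no-binary-conflict⇒no-conflict em N struct reach finite nonempty no-binary
  where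
  open Net N

  no-binary : ∀ {t u s} → t ≢ u → (•ᵗ t) ⊆ᴹ M → (•ᵗ u) ⊆ᴹ M →
              0 < Fˢᵗ s t → 0 < Fˢᵗ s u → ⊥
  no-binary {t} {u} {s} t≢u •t⊆M •u⊆M ct cu =
    -- One history serves both continuations, which makes the two ranks equal.
    let _ , _ , history = reachable⇒history em N t reach
        x , πx≡t , rx = largest-ranked struct s largest history •t⊆M ct
        y , πy≡u , ry = largest-ranked struct s largest history •u⊆M cu
        x≡y = rank-injective s struct P
                (subst (λ v → 0 < Fˢᵗ s v) (sym πx≡t) ct) (subst (λ v → 0 < Fˢᵗ s v) (sym πy≡u) cu) rx ry
    in t≢u (trans (sym πx≡t) (trans (cong (Process.πᵗ P) x≡y) πy≡u))
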